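{- Let $f = \sum_{S\subseteq [n]} a_S x^S \in \mathbb{R}[x_1,\dots,x_n]$ be a multiaffine polynomial, and consider the map $\sigma: \operatorname{supp}(f) \to \{\pm 1\}$ given by $S \mapsto \operatorname{sign}(a_S)$. If $f$ is real stable and $a_{\varnothing} > 0$, then $\sigma$ is an orientation of $\operatorname{supp}(f)$ with respect to $\varnothing$.
   Context: Notation: $[n]=\{1,\dots,n\}$; for $S\subseteq[n]$, $x^S=\prod_{i\in S}x_i$ and $e_S\in\{0,1\}^n$ is the indicator vector of $S$; $X\Delta Y$ denotes symmetric difference. A polynomial is multiaffine if it has degree at most one in each variable. For a multiaffine polynomial $f=\sum_{S\subseteq[n]} a_Sx^S$, $\operatorname{supp}(f)=\{S\subseteq[n] : a_S\neq 0\}$. A polynomial $f\in\mathbb{C}[x_1,\dots,x_n]$ is stable if $f(z_1,\dots,z_n)\neq 0$ whenever $\operatorname{Im}(z_1),\dots,\operatorname{Im}(z_n)>0$; it is real stable if in addition it has real coefficients. A $\Delta$-matroid is a nonempty collection $\mathcal{B}\subseteq 2^{[n]}$ such that for any $X,Y\in\mathcal{B}$ and any $i\in X\Delta Y$ there exists $j\in X\Delta Y$ (possibly $j=i$) with $X\Delta\{i,j\}\in\mathcal{B}$. Elements of $\mathcal{B}$ are called bases. Its polytope is $P_{\mathcal{B}}=\operatorname{conv}\{e_B : B\in\mathcal{B}\}$. All edges of a $\Delta$-matroid polytope have $\ell_1$-length one or two; an edge $[e_A,e_B]$ of $P_{\mathcal{B}}$ is called long if its $\ell_1$-length is two, i.e.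 $|A\Delta B|=2$. Fix a reference basis $F\in\mathcal{B}$. A long edge $[e_A,e_B]$ of $P_{\mathcal{B}}$ is horizontal (with respect to $F$) if $|A\Delta F|=|B\Delta F|$, and vertical (with respect to $F$) otherwise. A function $s_F:\mathcal{B}\to\{\pm1\}$ is an orientation of $\mathcal{B}$ with respect to $F\in\mathcal{B}$ if: (1) $\mathcal{B}$ is a $\Delta$-matroid; (2) if $[e_A,e_B]$ is a horizontal long edge of $P_{\mathcal{B}}$ relative to $F$, then $s_F(A)=s_F(B)$; (3) if $[e_A,e_B]$ is a vertical long edge of $P_{\mathcal{B}}$ relative to $F$, then $s_F(A)=-s_F(B)$; (4) for every two-dimensional face of the hypercube $[0,1]^n$ all four of whose vertices correspond to bases, if three of the vertices have the same sign under $s_F$ and the fourth has the opposite sign, then the vertex with the opposite sign is either the closest or the furthest vertex of that face from $F$ (distance between $A$ and $F$ being $|A\Delta F|$); (5) $s_F(F)=+1$. -}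

module Defs where

open import Algebra.Bundles using (CommutativeRing; RawMonoid; RawRing)
open import Algebra.Structures using (IsCommutativeRing)
import Algebra.Definitions.RawMonoid as RawMonoidDefs
import Algebra.Definitions.RawSemiring as RawSemiringDefs
open import Data.Bool.Base using (if_then_else_; _xor_)
open import Data.Empty using (⊥-elim-irr)
open import Data.Fin.Base using (Fin)
open import Data.Fin.Subset using (Subset; inside; outside; _∈_; _∉_; _∪_; ⁅_⁆; ∣_∣)
open import Data.Nat.Base as ℕ using (ℕ; zero; suc)
open import Data.Product.Base using (Σ; ∃; ∃-syntax; _×_; _,_)
open import Data.Sign.Base using (Sign; opposite)
open import Data.Sum.Base using (_⊎_)
open import Data.Vec.Base using ([]; _∷_; lookup; zipWith)
open import Data.Vec.Functional using (Vector)
open import Function.Bundles using (_⇔_)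
open import Level using (Level; _⊔_) renaming (suc to lsuc)
open import Relation.Binary.Core using (Rel)
open import Relation.Binary.Definitions using (tri<; tri≈; tri>)
open import Relation.Binary.PropositionalEquality.Core using (_≡_; _≢_)
open import Relation.Binary.Structures using (IsStrictTotalOrder)
open import Relation.Nullary.Negation.Core using (¬_)
open import Relation.Unary using (Pred)

private
  variable
    n : ℕ

-- The real numbers, given by their classical axioms: a Dedekind-complete
-- ordered field, which is unique up to isomorphism.  Trichotomy is part of
-- IsStrictTotalOrder, so signs can be decided as in classical mathematics.

record RealNumbers c ℓ₁ ℓ₂ : Set (lsuc (c ⊔ ℓ₁ ⊔ ℓ₂)) where
  infix  8 -_
  infixl 7 _*_
  infixl 6 _+_
  infix  4 _≈_ _<_ _≤_
  field
    Carrier            : Set c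
    _≈_                : Rel Carrier ℓ₁
    _<_                : Rel Carrier ℓ₂
    _+_ _*_            : Carrier → Carrier → Carrier
    -_                 : Carrier → Carrier
    0# 1#              : Carrier
    isCommutativeRing  : IsCommutativeRing _≈_ _+_ _*_ -_ 0# 1#
    0≉1                : ¬ (0# ≈ 1#)
    inverse            : ∀ x → ¬ (x ≈ 0#) → ∃[ y ] x * y ≈ 1#
    isStrictTotalOrder : IsStrictTotalOrder _≈_ _<_
    +-monoˡ-<          : ∀ z {x y} → x < y → x + z < y + z
    *-pos              : ∀ {x y} → 0# < x → 0# < y → 0# < x * y

  _≤_ : Rel Carrier (ℓ₁ ⊔ ℓ₂)
  x ≤ y = x < y ⊎ x ≈ y

  UpperBound : ∀ {ℓ} → Pred Carrier ℓ → Carrier → Set (c ⊔ ℓ₁ ⊔ ℓ₂ ⊔ ℓ)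
  UpperBound X u = ∀ x → X x → x ≤ u

  field
    complete : (X : Pred Carrier (c ⊔ ℓ₁ ⊔ ℓ₂)) → ∃ X → ∃ (UpperBound X) →
               ∃[ s ] UpperBound X s × (∀ u → UpperBound X u → s ≤ u)

  commutativeRing : CommutativeRing c ℓ₁
  commutativeRing = record { isCommutativeRing = isCommutativeRing }

  open CommutativeRing commutativeRing public using (rawRing)
  open IsStrictTotalOrder isStrictTotalOrder public using (compare)

module _ {a ℓ} (M : RawMonoid a ℓ) where
  open RawMonoid M

  sumSubsets : (Subset n → Carrier) → Carrier
  sumSubsets {zero}  g = g []
  sumSubsets {suc n} g =
    sumSubsets (λ S → g (outside ∷ S)) ∙ sumSubsets (λ S → g (inside ∷ S))

-- A multiaffine polynomial Σ a_S x^S is represented by its coefficient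
-- family S ↦ a_S.

module _ {a ℓ} (K : RawRing a ℓ) where
  open RawRing K
  open RawSemiringDefs rawSemiring using (product)

  Multiaffine : ℕ → Set a
  Multiaffine n = Subset n → Carrier

  monomial : Subset n → Vector Carrier n → Carrier
  monomial S z = product λ i → if lookup S i then z i else 1#

  eval : Multiaffine n → Vector Carrier n → Carrier
  eval f z = sumSubsets +-rawMonoid λ S → f S * monomial S z

  supp : Multiaffine n → Pred (Subset n) ℓ
  supp f S = ¬ (f S ≈ 0#)

infixl 6 _△_

_△_ : Subset n → Subset n → Subset n
_△_ = zipWith _xor_

record IsΔMatroid {ℓ} (ℬ : Pred (Subset n) ℓ) : Set ℓ where
  field
    nonempty : ∃ ℬ
    exchange : ∀ {X Y} → ℬ X → ℬ Y → ∀ {i} → i ∈ X △ Y →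
               ∃[ j ] j ∈ X △ Y × ℬ (X △ (⁅ i ⁆ ∪ ⁅ j ⁆))

-- Every face of [0,1]ⁿ arises by fixing the coordinates outside some D to 0/1
-- values T, and has dimension ∣ D ∣.  This is the vertex set of that face.
-- (The values of T on D are irrelevant.)

CubeFace : (D T : Subset n) → Pred (Subset n) _
CubeFace D T V = ∀ k → k ∉ D → lookup V k ≡ lookup T k

Closest Furthest : ∀ {ℓ} (F : Subset n) (Q : Pred (Subset n) ℓ) → Pred (Subset n) ℓ
Closest  F Q V = ∀ W → Q W → ∣ V △ F ∣ ℕ.≤ ∣ W △ F ∣
Furthest F Q V = ∀ W → Q W → ∣ W △ F ∣ ℕ.≤ ∣ V △ F ∣

module _ {c ℓ₁ ℓ₂} (ℝ : RealNumbers c ℓ₁ ℓ₂) where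
  open RealNumbers ℝ
  open RawMonoidDefs (RawRing.+-rawMonoid rawRing) using (sum)

  record Complex : Set c where
    constructor _+i_
    field
      re im : Carrier

  open Complex

  complexRing : RawRing c ℓ₁
  complexRing = record
    { Carrier = Complex
    ; _≈_     = λ z w → re z ≈ re w × im z ≈ im w
    ; _+_     = λ z w → (re z + re w) +i (im z + im w)
    ; _*_     = λ z w → (re z * re w + - (im z * im w)) +i (re z * im w + im z * re w)
    ; -_      = λ z → (- re z) +i (- im z)
    ; 0#      = 0# +i 0#
    ; 1#      = 1# +i 0#
    }

  Stable : Multiaffine complexRing n → Set (c ⊔ ℓ₁ ⊔ ℓ₂)
  Stable {n} f = (z : Vector Complex n) → (∀ i → 0# < im (z i)) →
                 ¬ (RawRing._≈_ complexRing (eval complexRing f z) (RawRing.0# complexRing))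

  RealStable : Multiaffine rawRing n → Set (c ⊔ ℓ₁ ⊔ ℓ₂)
  RealStable f = Stable λ S → f S +i 0#

  sign : (x : Carrier) → .(¬ (x ≈ 0#)) → Sign
  sign x x≉0 with compare x 0#
  ... | tri< _ _ _   = Sign.-
  ... | tri≈ _ x≈0 _ = ⊥-elim-irr (x≉0 x≈0)
  ... | tri> _ _ _   = Sign.+

  coefficientSign : (f : Multiaffine rawRing n) (S : Subset n) → .(supp rawRing f S) → Sign
  coefficientSign f S = sign (f S)

  Point : ℕ → Set c
  Point = Vector Carrier

  indicator : Subset n → Point n
  indicator S i = if lookup S i then 1# else 0#

  dot : Point n → Point n → Carrier
  dot u v = sum λ i → u i * v i

  conv : ∀ {ℓ} → Pred (Point n) ℓ → Pred (Point n) (c ⊔ ℓ₁ ⊔ ℓ₂ ⊔ ℓ)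
  conv {n} X x = ∃[ k ] Σ (Vector Carrier k) λ w → Σ (Vector (Point n) k) λ p →
    (∀ j → X (p j)) × (∀ j → 0# ≤ w j) × sum w ≈ 1# ×
    (∀ i → x i ≈ sum λ j → w j * p j i)

  polytope : ∀ {ℓ} → Pred (Subset n) ℓ → Pred (Point n) (c ⊔ ℓ₁ ⊔ ℓ₂ ⊔ ℓ)
  polytope ℬ = conv λ x → ∃[ B ] ℬ B × (∀ i → x i ≈ indicator B i)

  segment : Point n → Point n → Pred (Point n) (c ⊔ ℓ₁ ⊔ ℓ₂)
  segment u v x = ∃[ t ] 0# ≤ t × t ≤ 1# × (∀ i → x i ≈ (1# + - t) * u i + t * v i)

  -- [u,v] is a one-dimensional face of P: the set of points of P at which
  -- some inequality that is valid on P holds with equality.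
  record IsEdge {ℓ} (P : Pred (Point n) ℓ) (u v : Point n) : Set (c ⊔ ℓ₁ ⊔ ℓ₂ ⊔ ℓ) where
    field
      distinct : ¬ (∀ i → u i ≈ v i)
      normal   : Point n
      bound    : Carrier
      valid    : ∀ x → P x → dot normal x ≤ bound
      face     : ∀ x → (P x × dot normal x ≈ bound) ⇔ segment u v x

  LongEdge : ∀ {ℓ} → Pred (Subset n) ℓ → (A B : Subset n) → Set (c ⊔ ℓ₁ ⊔ ℓ₂ ⊔ ℓ)
  LongEdge ℬ A B = IsEdge (polytope ℬ) (indicator A) (indicator B) × ∣ A △ B ∣ ≡ 2

  HorizontalLongEdge VerticalLongEdge :
    ∀ {ℓ} → Pred (Subset n) ℓ → (F A B : Subset n) → Set (c ⊔ ℓ₁ ⊔ ℓ₂ ⊔ ℓ)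
  HorizontalLongEdge ℬ F A B = LongEdge ℬ A B × ∣ A △ F ∣ ≡ ∣ B △ F ∣
  VerticalLongEdge   ℬ F A B = LongEdge ℬ A B × ∣ A △ F ∣ ≢ ∣ B △ F ∣

  -- Irrelevance of the membership proof makes s a function of the basis alone.
  record IsOrientation {ℓ} (ℬ : Pred (Subset n) ℓ) (F : Subset n)
                       (s : (S : Subset n) → .(ℬ S) → Sign) : Set (c ⊔ ℓ₁ ⊔ ℓ₂ ⊔ ℓ) where
    field
      isΔMatroid : IsΔMatroid ℬ
      reference  : ℬ F
      horizontal : ∀ {A B} (A∈ℬ : ℬ A) (B∈ℬ : ℬ B) →
                   HorizontalLongEdge ℬ F A B → s A A∈ℬ ≡ s B B∈ℬ
      vertical   : ∀ {A B} (A∈ℬ : ℬ A) (B∈ℬ : ℬ B) →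
                   VerticalLongEdge ℬ F A B → s A A∈ℬ ≡ opposite (s B B∈ℬ)
      square     : ∀ D T → ∣ D ∣ ≡ 2 →
                   (bases : ∀ V → CubeFace D T V → ℬ V) →
                   ∀ V (V∈ : CubeFace D T V) →
                   (∀ W (W∈ : CubeFace D T W) → W ≢ V →
                     s W (bases W W∈) ≡ opposite (s V (bases V V∈))) →
                   Closest F (CubeFace D T) V ⊎ Furthest F (CubeFace D T) V
      positive   : s F reference ≡ Sign.+

{-# OPTIONS --safe #-}
module Submission where

-- For a stable f = g + xᵢ h the quotient g / h of the two restrictions takes
-- values in the closed upper half-plane, since otherwise xᵢ = - g / h would be
-- a zero of f.  Such a sign condition passes to the boundary one variable at a
-- time, where every variable may be a real number or ∞.  With one variable xⱼ
-- left at i it is the Rayleigh inequality ∂ᵢf ∂ⱼf - f ∂ᵢ∂ⱼf ≥ 0 on all real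
-- points.
--
-- At the vertices of the cube the Rayleigh inequality relates the four
-- coefficients on a square face, a_oo a_ii ≤ a_oi a_io; the conditions on signs
-- follow, because on a square with a long edge as one diagonal the product over
-- the other diagonal vanishes.
--
-- For the exchange property suppose that X is in the support but that neither
-- X △ {i} nor any X △ {i,j} is.  Substituting a generic real value for one more
-- variable preserves this situation, because the Rayleigh inequality on a line
-- gives a quadratic without constant term, whose linear term must vanish.  By
-- induction no Y with i ∈ X △ Y is in the support.

open import Defs
open import Algebra.Bundles using (CommutativeRing; RawRing)
import Algebra.Definitions.RawMonoid as RawMonoidDefs
import Algebra.Properties.AbelianGroup as AbelianGroupProperties
import Algebra.Properties.CommutativeMonoid.Sum as SumProperties
import Algebra.Properties.CommutativeSemigroup as CommutativeSemigroupProperties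
import Algebra.Properties.Ring as RingProperties
import Algebra.Properties.Semiring.Mult.TCOptimised as Multiples
import Algebra.Solver.Ring as RingSolver
open import Algebra.Solver.Ring.AlmostCommutativeRing
  using (fromCommutativeRing; _-Raw-AlmostCommutative⟶_)
open import Data.Bool.Base using (Bool; true; false; not; if_then_else_; _xor_)
open import Data.Bool.Properties using (not-involutive; xor-identityʳ)
open import Data.Empty using (⊥-elim)
open import Data.Fin.Base using (Fin; zero; suc; punchIn; punchOut)
import Data.Fin.Properties as Fin
open import Data.Fin.Subset using (Subset; inside; outside; ⊥; ⁅_⁆; _∪_; _∈_; _∉_; ∣_∣)
open import Data.Fin.Subset.Properties using (_∈?_; ∪-identityˡ; ∪-identityʳ; ∪-idem; ∉⊥)
open import Data.Integer.Base as ℤ using (ℤ; +_; -[1+_]; _⊖_; _◃_; +-*-rawRing)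
import Data.Integer.Properties as ℤ
import Data.Maybe.Base as Maybe
open import Data.Nat.Base as ℕ using (ℕ; zero; suc)
import Data.Nat.Properties as ℕ
open import Data.Product.Base using (∃-syntax; _×_; _,_; proj₁; proj₂)
open import Data.Sign.Base as Sign using (Sign; opposite)
open import Data.Sum.Base using (_⊎_; inj₁; inj₂)
open import Data.Vec.Base using (Vec; []; _∷_; here; there; insertAt; removeAt; lookup)
import Data.Vec.Functional as Functional
open import Data.Vec.Properties
  using (insertAt-lookup; insertAt-punchIn; insertAt-removeAt; lookup⇒[]=; []=⇒lookup;
         lookup-zipWith; tabulate∘lookup; tabulate-cong)
open import Function.Base using (_∘_; _$_; case_of_)
open import Function.Bundles using (Equivalence)
open import Level using (_⊔_)
open import Relation.Binary.Definitions using (tri<; tri≈; tri>)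
open import Relation.Binary.PropositionalEquality as ≡ using (_≡_; _≢_)
import Relation.Binary.Reasoning.Setoid as SetoidReasoning
open import Relation.Binary.Structures using (IsStrictTotalOrder)
open import Relation.Nullary.Decidable using (yes; no; ¬?; _×-dec_; dec⇒maybe; decidable-stable)
open import Relation.Nullary.Negation.Core using (¬_; contradiction)
open import Relation.Unary using (Pred)

private
  variable
    n : ℕ

-- Subsets and square faces of the cube

module SubsetProperties where
  open ≡ using (refl; sym; trans; cong; cong₂; subst₂)

  △-identityʳ : ∀ (X : Subset n) → X △ ⊥ ≡ X
  △-identityʳ []      = refl
  △-identityʳ (x ∷ X) = cong₂ _∷_ (xor-identityʳ x) (△-identityʳ X)

  △-cancelˡ : ∀ (X Y : Subset n) → X △ (X △ Y) ≡ Y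
  △-cancelˡ [] []                    = refl
  △-cancelˡ (true  ∷ X) (true  ∷ Y)  = cong (_ ∷_) (△-cancelˡ X Y)
  △-cancelˡ (true  ∷ X) (false ∷ Y)  = cong (_ ∷_) (△-cancelˡ X Y)
  △-cancelˡ (false ∷ X) (y ∷ Y)      = cong (_ ∷_) (△-cancelˡ X Y)

  xor-trueʳ : ∀ x → x xor true ≡ not x
  xor-trueʳ true  = refl
  xor-trueʳ false = refl

  △-⁅zero⁆ : ∀ x (X : Subset n) → (x ∷ X) △ ⁅ zero ⁆ ≡ not x ∷ X
  △-⁅zero⁆ x X = cong₂ _∷_ (xor-trueʳ x) (△-identityʳ X)

  △-⁅suc⁆ : ∀ x (X : Subset n) j → (x ∷ X) △ ⁅ suc j ⁆ ≡ x ∷ (X △ ⁅ j ⁆)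
  △-⁅suc⁆ x X j = cong (_∷ _) (xor-identityʳ x)

  insertAt-△ : ∀ (X Y : Subset n) i x y → insertAt X i x △ insertAt Y i y ≡ insertAt (X △ Y) i (x xor y)
  insertAt-△ X       Y       zero    x y = refl
  insertAt-△ (_ ∷ X) (_ ∷ Y) (suc i) x y = cong (_ ∷_) (insertAt-△ X Y i x y)

  ⁅⁆-insertAt : ∀ (i : Fin (suc n)) → ⁅ i ⁆ ≡ insertAt ⊥ i inside
  ⁅⁆-insertAt zero            = refl
  ⁅⁆-insertAt {suc n} (suc i) = cong (outside ∷_) (⁅⁆-insertAt i)

  ⁅⁆∪⁅punchIn⁆ : ∀ (i : Fin (suc n)) j → ⁅ i ⁆ ∪ ⁅ punchIn i j ⁆ ≡ insertAt ⁅ j ⁆ i inside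
  ⁅⁆∪⁅punchIn⁆ zero j            = cong (inside ∷_) (∪-identityˡ ⁅ j ⁆)
  ⁅⁆∪⁅punchIn⁆ (suc i) zero      = cong (inside ∷_) (trans (∪-identityʳ ⁅ i ⁆) (⁅⁆-insertAt i))
  ⁅⁆∪⁅punchIn⁆ (suc i) (suc j)   = cong (outside ∷_) (⁅⁆∪⁅punchIn⁆ i j)

  ∈-insertAt : ∀ {X : Subset n} {j} i x → j ∈ X → punchIn i j ∈ insertAt X i x
  ∈-insertAt {X = X} {j} i x j∈X =
    lookup⇒[]= _ _ (trans (insertAt-punchIn X i x j) ([]=⇒lookup j∈X))

  ∈△⇒lookup-not : ∀ {X Y : Subset n} {i} → i ∈ X △ Y → lookup Y i ≡ not (lookup X i)
  ∈△⇒lookup-not {X = X} {Y} {i} i∈ =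
    xor-true _ _ (trans (sym (lookup-zipWith _xor_ i X Y)) ([]=⇒lookup i∈))
    where
    xor-true : ∀ x y → x xor y ≡ true → y ≡ not x
    xor-true true  false _ = refl
    xor-true false true  _ = refl

  insertAt-△-⁅⁆∪⁅⁆ : ∀ (X : Subset n) i x → insertAt X i x △ (⁅ i ⁆ ∪ ⁅ i ⁆) ≡ insertAt X i (not x)
  insertAt-△-⁅⁆∪⁅⁆ X i x = trans (cong (insertAt X i x △_) (trans (∪-idem ⁅ i ⁆) (⁅⁆-insertAt i)))
    (trans (insertAt-△ X ⊥ i x true) (cong₂ (λ X x → insertAt X i x) (△-identityʳ X) (xor-trueʳ x)))

  insertAt-△-⁅⁆∪⁅punchIn⁆ : ∀ (X : Subset n) i j x →
    insertAt X i x △ (⁅ i ⁆ ∪ ⁅ punchIn i j ⁆) ≡ insertAt (X △ ⁅ j ⁆) i (not x)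
  insertAt-△-⁅⁆∪⁅punchIn⁆ X i j x = trans (cong (insertAt X i x △_) (⁅⁆∪⁅punchIn⁆ i j))
    (trans (insertAt-△ X ⁅ j ⁆ i x true) (cong (insertAt (X △ ⁅ j ⁆) i) (xor-trueʳ x)))

  lookup-ext : ∀ {X Y : Subset n} → (∀ k → lookup X k ≡ lookup Y k) → X ≡ Y
  lookup-ext {X = X} {Y} X≗Y =
    trans (sym (tabulate∘lookup X)) (trans (tabulate-cong X≗Y) (tabulate∘lookup Y))

  -- The four subsets corner i j T α β are the vertices of a square face of the
  -- cube.  The index j refers to the coordinates other than i.

  corner : Fin (suc (suc n)) → Fin (suc n) → Subset n → Bool → Bool → Subset (suc (suc n))
  corner i j T α β = insertAt (insertAt T j β) i α

  ∣insertAt-inside∣ : ∀ (X : Subset n) i → ∣ insertAt X i inside ∣ ≡ suc ∣ X ∣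
  ∣insertAt-inside∣ X             zero    = refl
  ∣insertAt-inside∣ (inside ∷ X)  (suc i) = cong suc (∣insertAt-inside∣ X i)
  ∣insertAt-inside∣ (outside ∷ X) (suc i) = ∣insertAt-inside∣ X i

  ∣insertAt-outside∣ : ∀ (X : Subset n) i → ∣ insertAt X i outside ∣ ≡ ∣ X ∣
  ∣insertAt-outside∣ X             zero    = refl
  ∣insertAt-outside∣ (inside ∷ X)  (suc i) = cong suc (∣insertAt-outside∣ X i)
  ∣insertAt-outside∣ (outside ∷ X) (suc i) = ∣insertAt-outside∣ X i

  module Corner (i : Fin (suc (suc n))) (j : Fin (suc n)) where

    lookup-cornerˡ : ∀ T α β → lookup (corner i j T α β) i ≡ α
    lookup-cornerˡ T α β = insertAt-lookup (insertAt T j β) i α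

    lookup-cornerʳ : ∀ T α β → lookup (corner i j T α β) (punchIn i j) ≡ β
    lookup-cornerʳ T α β = trans (insertAt-punchIn (insertAt T j β) i α j) (insertAt-lookup T j β)

    corner-injectiveˡ : ∀ {T α β α′ β′} → corner i j T α β ≡ corner i j T α′ β′ → α ≡ α′
    corner-injectiveˡ {T} eq =
      trans (sym (lookup-cornerˡ T _ _)) (trans (cong (λ V → lookup V i) eq) (lookup-cornerˡ T _ _))

    corner-injectiveʳ : ∀ {T α β α′ β′} → corner i j T α β ≡ corner i j T α′ β′ → β ≡ β′
    corner-injectiveʳ {T} eq =
      trans (sym (lookup-cornerʳ T _ _)) (trans (cong (λ V → lookup V (punchIn i j)) eq) (lookup-cornerʳ T _ _))

    -- The case depends on `k` alone and not on `T`, `α`, `β`, so one case split compares any number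
    -- of corners at the coordinate `k`.
    lookup-corner : ∀ k → (∀ T α β → lookup (corner i j T α β) k ≡ α) ⊎
                          (∀ T α β → lookup (corner i j T α β) k ≡ β) ⊎
                          (∃[ l ] ∀ T α β → lookup (corner i j T α β) k ≡ lookup T l)
    lookup-corner k with i Fin.≟ k
    ... | yes refl = inj₁ lookup-cornerˡ
    ... | no i≢k with punchOut i≢k | Fin.punchIn-punchOut i≢k
    ...   | l | refl with j Fin.≟ l
    ...     | yes refl = inj₂ (inj₁ lookup-cornerʳ)
    ...     | no j≢l = inj₂ (inj₂ (punchOut j≢l , λ T α β →
                trans (insertAt-punchIn (insertAt T j β) i α l)
                  (trans (cong (lookup (insertAt T j β)) (sym (Fin.punchIn-punchOut j≢l)))
                         (insertAt-punchIn T j β (punchOut j≢l)))))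

    ∣corner∣-ii : ∀ T → ∣ corner i j T inside inside ∣ ≡ suc (suc ∣ T ∣)
    ∣corner∣-ii T = trans (∣insertAt-inside∣ _ i) (cong suc (∣insertAt-inside∣ T j))

    ∣corner∣-io : ∀ T → ∣ corner i j T inside outside ∣ ≡ suc ∣ T ∣
    ∣corner∣-io T = trans (∣insertAt-inside∣ _ i) (cong suc (∣insertAt-outside∣ T j))

    ∣corner∣-oi : ∀ T → ∣ corner i j T outside inside ∣ ≡ suc ∣ T ∣
    ∣corner∣-oi T = trans (∣insertAt-outside∣ _ i) (∣insertAt-inside∣ T j)

    ∣corner∣-oo : ∀ T → ∣ corner i j T outside outside ∣ ≡ ∣ T ∣
    ∣corner∣-oo T = trans (∣insertAt-outside∣ _ i) (∣insertAt-outside∣ T j)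

    ∣corner∣≥ : ∀ T α β → ∣ corner i j T outside outside ∣ ℕ.≤ ∣ corner i j T α β ∣
    ∣corner∣≥ T true  true  rewrite ∣corner∣-oo T | ∣corner∣-ii T = ℕ.m≤n+m ∣ T ∣ 2
    ∣corner∣≥ T true  false rewrite ∣corner∣-oo T | ∣corner∣-io T = ℕ.n≤1+n ∣ T ∣
    ∣corner∣≥ T false true  rewrite ∣corner∣-oo T | ∣corner∣-oi T = ℕ.n≤1+n ∣ T ∣
    ∣corner∣≥ T false false = ℕ.≤-refl

    ∣corner∣≤ : ∀ T α β → ∣ corner i j T α β ∣ ℕ.≤ ∣ corner i j T inside inside ∣
    ∣corner∣≤ T true  true  = ℕ.≤-refl
    ∣corner∣≤ T true  false rewrite ∣corner∣-ii T | ∣corner∣-io T = ℕ.n≤1+n (suc ∣ T ∣)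
    ∣corner∣≤ T false true  rewrite ∣corner∣-ii T | ∣corner∣-oi T = ℕ.n≤1+n (suc ∣ T ∣)
    ∣corner∣≤ T false false rewrite ∣corner∣-ii T | ∣corner∣-oo T = ℕ.m≤n+m ∣ T ∣ 2

    base : Subset (suc (suc n)) → Subset n
    base V = removeAt (removeAt V i) j

    corner-base : ∀ V → corner i j (base V) (lookup V i) (lookup (removeAt V i) j) ≡ V
    corner-base V = trans (cong (λ X → insertAt X i (lookup V i)) (insertAt-removeAt (removeAt V i) j))
                          (insertAt-removeAt V i)

    corner-△ : ∀ T α β → corner i j T α β △ corner i j ⊥ inside inside ≡ corner i j T (not α) (not β)
    corner-△ T α β = trans (insertAt-△ _ _ i α true)
      (cong₂ (λ X x → insertAt X i x) (trans (insertAt-△ T ⊥ j β true)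
        (cong₂ (λ X x → insertAt X j x) (△-identityʳ T) (xor-trueʳ β))) (xor-trueʳ α))

    corner∈face : ∀ T α β → CubeFace (corner i j ⊥ inside inside) T (corner i j (base T) α β)
    corner∈face T α β k k∉ with lookup-corner k
    ... | inj₁ eq              = contradiction (lookup⇒[]= _ _ (eq ⊥ inside inside)) k∉
    ... | inj₂ (inj₁ eq)       = contradiction (lookup⇒[]= _ _ (eq ⊥ inside inside)) k∉
    ... | inj₂ (inj₂ (l , eq)) = trans (eq (base T) α β)
      (trans (sym (eq (base T) _ _)) (cong (λ V → lookup V k) (corner-base T)))

    -- Off the two directions of the square `V` agrees with `T`; on them the corner takes its values
    -- from `V`, and `base` has discarded those of `T`.
    face⇒corner : ∀ T V → CubeFace (corner i j ⊥ inside inside) T V →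
                  V ≡ corner i j (base T) (lookup V i) (lookup (removeAt V i) j)
    face⇒corner T V V∈ = lookup-ext agree
      where
      agree : ∀ k → lookup V k ≡ lookup (corner i j (base T) (lookup V i) (lookup (removeAt V i) j)) k
      agree k with lookup-corner k
      ... | inj₁ eq = trans (trans (cong (λ V → lookup V k) (sym (corner-base V))) (eq (base V) _ _))
                            (sym (eq (base T) _ _))
      ... | inj₂ (inj₁ eq) = trans (trans (cong (λ V → lookup V k) (sym (corner-base V))) (eq (base V) _ _))
                                   (sym (eq (base T) _ _))
      ... | inj₂ (inj₂ (l , eq)) = trans (V∈ k k∉)
        (trans (cong (λ V → lookup V k) (sym (corner-base T))) (trans (eq (base T) _ _) (sym (eq (base T) _ _))))
        where
        k∉ : k ∉ corner i j ⊥ inside inside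
        k∉ k∈ = ∉⊥ (lookup⇒[]= l ⊥ (trans (sym (eq ⊥ inside inside)) ([]=⇒lookup k∈)))

  -- A view: matching on `pair` yields the two directions of a square and also refines the dimension
  -- to `suc (suc n)`.
  data TwoElements : Subset n → Set where
    pair : ∀ (i : Fin (suc (suc n))) j → TwoElements (corner i j ⊥ inside inside)

  ∣p∣≡0⇒p≡⊥ : ∀ (p : Subset n) → ∣ p ∣ ≡ 0 → p ≡ ⊥
  ∣p∣≡0⇒p≡⊥ []            _  = refl
  ∣p∣≡0⇒p≡⊥ (outside ∷ p) eq = cong (outside ∷_) (∣p∣≡0⇒p≡⊥ p eq)

  ∣p∣≡1⇒singleton : ∀ (p : Subset (suc n)) → ∣ p ∣ ≡ 1 → ∃[ i ] p ≡ insertAt ⊥ i inside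
  ∣p∣≡1⇒singleton (inside ∷ p) eq = zero , cong (inside ∷_) (∣p∣≡0⇒p≡⊥ p (ℕ.suc-injective eq))
  ∣p∣≡1⇒singleton {suc n} (outside ∷ p) eq with i , refl ← ∣p∣≡1⇒singleton p eq = suc i , refl
  ∣p∣≡1⇒singleton {zero} (outside ∷ []) ()

  ∣p∣≡2⇒TwoElements : ∀ (p : Subset n) → ∣ p ∣ ≡ 2 → TwoElements p
  ∣p∣≡2⇒TwoElements {suc (suc n)} (inside ∷ p) eq
    with j , refl ← ∣p∣≡1⇒singleton p (ℕ.suc-injective eq) = pair zero j
  ∣p∣≡2⇒TwoElements {suc zero} (inside ∷ []) ()
  ∣p∣≡2⇒TwoElements (outside ∷ p) eq with ∣p∣≡2⇒TwoElements p eq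
  ... | pair i j = pair (suc i) (suc j)

  -- Two subsets at distance two are opposite corners of a square. Their sizes differ by two if `α`
  -- equals `β` and coincide otherwise, so matching on the Booleans separates vertical from
  -- horizontal edges.
  data Diagonal : (A B : Subset n) → Set where
    diagonal : ∀ i j (T : Subset n) α β → Diagonal (corner i j T α β) (corner i j T (not α) (not β))

  ∣A△B∣≡2⇒Diagonal : ∀ (A B : Subset n) → ∣ A △ B ∣ ≡ 2 → Diagonal A B
  ∣A△B∣≡2⇒Diagonal A B eq = go (∣p∣≡2⇒TwoElements (A △ B) eq) refl
    where
    -- `D` is a variable tied to `A △ B` by an equation, since `A △ B` itself does not unify with a
    -- corner.
    go : ∀ {D} → TwoElements D → A △ B ≡ D → Diagonal A B
    go (pair i j) A△B≡D = subst₂ Diagonal (corner-base A)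
      (trans (sym (corner-△ (base A) _ _))
        (trans (cong₂ _△_ (corner-base A) (sym A△B≡D)) (△-cancelˡ A B)))
      (diagonal i j (base A) (lookup A i) (lookup (removeAt A i) j))
      where open Corner i j

open SubsetProperties

-- Multiaffine polynomials over a commutative ring

module IntegerSolver {c ℓ} (R : CommutativeRing c ℓ) where
  open CommutativeRing R
  open RingProperties ring
  open AbelianGroupProperties +-abelianGroup using (⁻¹-∙-comm; ⁻¹-involutive)
  open Multiples semiring using (×-homo-+; ×1-homo-*; 1+×) renaming (_×_ to infixl 8 _·_)
  open CommutativeSemigroupProperties +-commutativeSemigroup using (interchange)
  open SetoidReasoning setoid

  -- Integer coefficients give the ring solver a decidable equality that `R` need not have. The
  -- optimised multiples make `con (+ 0)` and `con (+ 1)` equal to `0#` and `1#` by definition, so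
  -- solver identities fit goals stated with these.
  fromℤ : ℤ → Carrier
  fromℤ (+ n)    = n · 1#
  fromℤ -[1+ n ] = - (suc n · 1#)

  fromℤ-⊖ : ∀ m n → fromℤ (m ⊖ n) ≈ m · 1# + - (n · 1#)
  fromℤ-⊖ m zero = sym (trans (+-congˡ -0#≈0#) (+-identityʳ _))
  fromℤ-⊖ zero (suc n) = sym (+-identityˡ _)
  fromℤ-⊖ (suc m) (suc n) = begin
    fromℤ (suc m ⊖ suc n)                     ≡⟨ ≡.cong fromℤ (ℤ.[1+m]⊖[1+n]≡m⊖n m n) ⟩
    fromℤ (m ⊖ n)                             ≈⟨ fromℤ-⊖ m n ⟩
    m · 1# + - (n · 1#)                       ≈⟨ +-identityˡ _ ⟨
    0# + (m · 1# + - (n · 1#))                ≈⟨ +-congʳ (-‿inverseʳ 1#) ⟨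
    (1# + - 1#) + (m · 1# + - (n · 1#))       ≈⟨ interchange _ _ _ _ ⟩
    (1# + m · 1#) + (- 1# + - (n · 1#))       ≈⟨ +-congˡ (⁻¹-∙-comm _ _) ⟩
    (1# + m · 1#) + - (1# + n · 1#)           ≈⟨ +-cong (1+× m 1#) (-‿cong (1+× n 1#)) ⟨
    suc m · 1# + - (suc n · 1#)               ∎

  fromℤ-◃+ : ∀ n → fromℤ (Sign.+ ◃ n) ≈ n · 1#
  fromℤ-◃+ zero    = refl
  fromℤ-◃+ (suc n) = refl

  fromℤ-◃- : ∀ n → fromℤ (Sign.- ◃ n) ≈ - (n · 1#)
  fromℤ-◃- zero    = sym -0#≈0#
  fromℤ-◃- (suc n) = refl

  fromℤ-+ : ∀ i j → fromℤ (i ℤ.+ j) ≈ fromℤ i + fromℤ j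
  fromℤ-+ (+ m)    (+ n)    = ×-homo-+ 1# m n
  fromℤ-+ (+ m)    -[1+ n ] = fromℤ-⊖ m (suc n)
  fromℤ-+ -[1+ m ] (+ n)    = trans (fromℤ-⊖ n (suc m)) (+-comm _ _)
  fromℤ-+ -[1+ m ] -[1+ n ] = begin
    - (suc (suc (m ℕ.+ n)) · 1#)        ≡⟨ ≡.cong (λ k → - (suc k · 1#)) (≡.sym (ℕ.+-suc m n)) ⟩
    - ((suc m ℕ.+ suc n) · 1#)          ≈⟨ -‿cong (×-homo-+ 1# (suc m) (suc n)) ⟩
    - (suc m · 1# + suc n · 1#)         ≈⟨ ⁻¹-∙-comm _ _ ⟨
    - (suc m · 1#) + - (suc n · 1#)     ∎

  fromℤ-* : ∀ i j → fromℤ (i ℤ.* j) ≈ fromℤ i * fromℤ j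
  fromℤ-* (+ m)    (+ n)    = trans (fromℤ-◃+ (m ℕ.* n)) (×1-homo-* m n)
  fromℤ-* (+ m)    -[1+ n ] = begin
    fromℤ (Sign.- ◃ (m ℕ.* suc n))      ≈⟨ fromℤ-◃- (m ℕ.* suc n) ⟩
    - ((m ℕ.* suc n) · 1#)              ≈⟨ -‿cong (×1-homo-* m (suc n)) ⟩
    - ((m · 1#) * (suc n · 1#))         ≈⟨ -‿distribʳ-* _ _ ⟩
    (m · 1#) * - (suc n · 1#)           ∎
  fromℤ-* -[1+ m ] (+ n)    = begin
    fromℤ (Sign.- ◃ (suc m ℕ.* n))      ≈⟨ fromℤ-◃- (suc m ℕ.* n) ⟩
    - ((suc m ℕ.* n) · 1#)              ≈⟨ -‿cong (×1-homo-* (suc m) n) ⟩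
    - ((suc m · 1#) * (n · 1#))         ≈⟨ -‿distribˡ-* _ _ ⟩
    - (suc m · 1#) * (n · 1#)           ∎
  fromℤ-* -[1+ m ] -[1+ n ] = begin
    (suc m ℕ.* suc n) · 1#              ≈⟨ ×1-homo-* (suc m) (suc n) ⟩
    (suc m · 1#) * (suc n · 1#)         ≈⟨ ⁻¹-involutive _ ⟨
    - - ((suc m · 1#) * (suc n · 1#))   ≈⟨ -‿cong (-‿distribˡ-* _ _) ⟩
    - (- (suc m · 1#) * (suc n · 1#))   ≈⟨ -‿distribʳ-* _ _ ⟩
    - (suc m · 1#) * - (suc n · 1#)     ∎

  fromℤ-neg : ∀ i → fromℤ (ℤ.- i) ≈ - fromℤ i
  fromℤ-neg (+ zero)   = sym -0#≈0#
  fromℤ-neg (+ suc n)  = refl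
  fromℤ-neg -[1+ n ]   = sym (⁻¹-involutive _)

  fromℤ-homomorphism : +-*-rawRing -Raw-AlmostCommutative⟶ fromCommutativeRing R
  fromℤ-homomorphism = record
    { ⟦_⟧    = fromℤ
    ; +-homo = fromℤ-+
    ; *-homo = fromℤ-*
    ; -‿homo = fromℤ-neg
    ; 0-homo = refl
    ; 1-homo = refl
    }

  open RingSolver +-*-rawRing (fromCommutativeRing R) fromℤ-homomorphism
    (λ i j → Maybe.map (reflexive ∘ ≡.cong fromℤ) (dec⇒maybe (i ℤ.≟ j)))
    public using (solve; con; _:+_; _:*_; :-_; _:=_; Polynomial)

module Evaluation {c ℓ} (R : CommutativeRing c ℓ) where
  open CommutativeRing R hiding (zero)
  open IntegerSolver R
  open SetoidReasoning setoid

  private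
    ∑ : (Subset n → Carrier) → Carrier
    ∑ = sumSubsets (RawRing.+-rawMonoid rawRing)

  sumSubsets-cong : {g h : Subset n → Carrier} → (∀ S → g S ≈ h S) → ∑ g ≈ ∑ h
  sumSubsets-cong {zero}  g≈h = g≈h []
  sumSubsets-cong {suc n} g≈h =
    +-cong (sumSubsets-cong (g≈h ∘ (outside ∷_))) (sumSubsets-cong (g≈h ∘ (inside ∷_)))

  -- One induction gives additivity and scaling together; for scaling alone, `eval-suc` inserts a
  -- zero summand and takes `g` to be zero.
  sumSubsets-linear : ∀ c (g h : Subset n → Carrier) → ∑ (λ S → g S + c * h S) ≈ ∑ g + c * ∑ h
  sumSubsets-linear {zero}  c g h = refl
  sumSubsets-linear {suc n} c g h = trans
    (+-cong (sumSubsets-linear c (g ∘ (outside ∷_)) (h ∘ (outside ∷_)))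
            (sumSubsets-linear c (g ∘ (inside ∷_)) (h ∘ (inside ∷_))))
    (solve 5 (λ c a a′ b b′ →
        (a :+ c :* a′) :+ (b :+ c :* b′) := (a :+ b) :+ c :* (a′ :+ b′)) refl
      c _ _ _ _)

  eval-cong : ∀ {f g : Multiaffine rawRing n} z → (∀ S → f S ≈ g S) → eval rawRing f z ≈ eval rawRing g z
  eval-cong z f≈g = sumSubsets-cong λ S → *-congʳ (f≈g S)

  eval-linear : ∀ c (f g : Multiaffine rawRing n) z →
    eval rawRing (λ S → f S + c * g S) z ≈ eval rawRing f z + c * eval rawRing g z
  eval-linear {n} c f g z = trans
    (sumSubsets-cong {n} λ S → solve 4 (λ c a b m → (a :+ c :* b) :* m := a :* m :+ c :* (b :* m)) refl
      c (f S) (g S) (monomial rawRing S z))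
    (sumSubsets-linear {n} c (λ S → f S * monomial rawRing S z) (λ S → g S * monomial rawRing S z))

  sumSubsets-zero : ∀ n → ∑ {n} (λ _ → 0#) ≈ 0#
  sumSubsets-zero zero    = refl
  sumSubsets-zero (suc n) = trans (+-cong (sumSubsets-zero n) (sumSubsets-zero n)) (+-identityˡ 0#)

  eval-suc : ∀ (f : Multiaffine rawRing (suc n)) (z : Functional.Vector Carrier (suc n)) →
    eval rawRing f z ≈ eval rawRing (f ∘ (outside ∷_)) (z ∘ suc) +
                       z zero * eval rawRing (f ∘ (inside ∷_)) (z ∘ suc)
  eval-suc {n} f z = begin
    ∑ (λ S → f (outside ∷ S) * (1# * m S)) + ∑ (λ S → f (inside ∷ S) * (z zero * m S))
      ≈⟨ +-cong
           (sumSubsets-cong {n} λ S → *-congˡ (*-identityˡ (m S)))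
           (sumSubsets-cong {n} λ S → solve 3 (λ a z m → a :* (z :* m) := con (+ 0) :+ z :* (a :* m)) refl
              (f (inside ∷ S)) (z zero) (m S)) ⟩
    e₀ + ∑ (λ S → 0# + z zero * (f (inside ∷ S) * m S))
      ≈⟨ +-congˡ (sumSubsets-linear (z zero) (λ _ → 0#) (λ S → f (inside ∷ S) * m S)) ⟩
    e₀ + (∑ {n} (λ _ → 0#) + z zero * e₁)
      ≈⟨ +-congˡ (trans (+-congʳ (sumSubsets-zero n)) (+-identityˡ _)) ⟩
    e₀ + z zero * e₁ ∎
    where
    m : Subset n → Carrier
    m S = monomial rawRing S (z ∘ suc)
    e₀ e₁ : Carrier
    e₀ = eval rawRing (f ∘ (outside ∷_)) (z ∘ suc)
    e₁ = eval rawRing (f ∘ (inside ∷_)) (z ∘ suc)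

  -- Splitting off the variable `i` commutes with splitting off the variable `zero`, so the
  -- induction step only regroups four terms.
  eval-insertAt : ∀ (f : Multiaffine rawRing (suc n)) i z x →
    eval rawRing f (Functional.insertAt z i x) ≈
    eval rawRing (λ S → f (insertAt S i outside)) z + x * eval rawRing (λ S → f (insertAt S i inside)) z
  eval-insertAt f zero z x = eval-suc f (Functional.insertAt z zero x)
  eval-insertAt {suc n} f (suc i) z x = begin
    eval rawRing f (Functional.insertAt z (suc i) x)
      ≈⟨ eval-suc f (Functional.insertAt z (suc i) x) ⟩
    eval rawRing (f ∘ (outside ∷_)) (Functional.insertAt (z ∘ suc) i x) +
    z zero * eval rawRing (f ∘ (inside ∷_)) (Functional.insertAt (z ∘ suc) i x)
      ≈⟨ +-cong (eval-insertAt (f ∘ (outside ∷_)) i (z ∘ suc) x)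
                (*-congˡ (eval-insertAt (f ∘ (inside ∷_)) i (z ∘ suc) x)) ⟩
    _ ≈⟨ solve 6 (λ z x a b c d → (a :+ x :* b) :+ z :* (c :+ x :* d) :=
                                  (a :+ z :* c) :+ x :* (b :+ z :* d)) refl
          (z zero) x _ _ _ _ ⟩
    _ ≈⟨ +-cong (eval-suc (λ S → f (insertAt S (suc i) outside)) z)
                (*-congˡ (eval-suc (λ S → f (insertAt S (suc i) inside)) z)) ⟨
    _ ∎

-- Real and complex numbers

module OrderedField {c ℓ₁ ℓ₂} (ℝ : RealNumbers c ℓ₁ ℓ₂) where
  open RealNumbers ℝ
  open CommutativeRing commutativeRing
    using (refl; sym; trans; setoid; +-cong; +-congˡ; +-congʳ; *-cong; *-congˡ; *-congʳ;
           +-identityˡ; +-identityʳ; -‿inverseʳ; *-identityˡ; zeroˡ; zeroʳ)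
  open IsStrictTotalOrder isStrictTotalOrder
    using (irrefl; <-respˡ-≈; <-respʳ-≈) renaming (trans to <-trans)
  open IntegerSolver commutativeRing

  <⇒0<- : ∀ {x y} → x < y → 0# < y + - x
  <⇒0<- {x} x<y = <-respˡ-≈ (-‿inverseʳ x) (+-monoˡ-< (- x) x<y)

  0<-⇒< : ∀ {x y} → 0# < y + - x → x < y
  0<-⇒< {x} {y} 0<y-x = <-respˡ-≈ (+-identityˡ x) (<-respʳ-≈
    (solve 2 (λ x y → (y :+ :- x) :+ x := y) refl x y) (+-monoˡ-< x 0<y-x))

  x<0⇒0<-x : ∀ {x} → x < 0# → 0# < - x
  x<0⇒0<-x x<0 = <-respʳ-≈ (+-identityˡ _) (<⇒0<- x<0)

  0<-x⇒x<0 : ∀ {x} → 0# < - x → x < 0#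
  0<-x⇒x<0 0<-x = 0<-⇒< (<-respʳ-≈ (sym (+-identityˡ _)) 0<-x)

  +-pos : ∀ {x y} → 0# < x → 0# < y → 0# < x + y
  +-pos {x} {y} 0<x 0<y = <-trans 0<y (<-respˡ-≈ (+-identityˡ y) (+-monoˡ-< y 0<x))

  ≤-resp-≈ : ∀ {x y} → x ≈ y → 0# ≤ x → 0# ≤ y
  ≤-resp-≈ x≈y (inj₁ 0<x) = inj₁ (<-respʳ-≈ x≈y 0<x)
  ≤-resp-≈ x≈y (inj₂ 0≈x) = inj₂ (trans 0≈x x≈y)

  +-pos-nonneg : ∀ {x y} → 0# < x → 0# ≤ y → 0# < x + y
  +-pos-nonneg 0<x (inj₁ 0<y) = +-pos 0<x 0<y
  +-pos-nonneg 0<x (inj₂ 0≈y) = <-respʳ-≈ (trans (sym (+-identityʳ _)) (+-congˡ 0≈y)) 0<x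

  *-pos-nonneg : ∀ {x y} → 0# < x → 0# ≤ y → 0# ≤ x * y
  *-pos-nonneg 0<x (inj₁ 0<y) = inj₁ (*-pos 0<x 0<y)
  *-pos-nonneg {x} 0<x (inj₂ 0≈y) = inj₂ (trans (sym (zeroʳ x)) (*-congˡ 0≈y))

  ≤⇒0≤- : ∀ {x y} → x ≤ y → 0# ≤ y + - x
  ≤⇒0≤- (inj₁ x<y) = inj₁ (<⇒0<- x<y)
  ≤⇒0≤- {x} (inj₂ x≈y) = inj₂ (trans (sym (-‿inverseʳ x)) (+-congʳ x≈y))

  ≮⇒0≤ : ∀ {x} → ¬ (x < 0#) → 0# ≤ x
  ≮⇒0≤ {x} x≮0 with compare x 0#
  ... | tri< x<0 _ _ = ⊥-elim (x≮0 x<0)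
  ... | tri≈ _ x≈0 _ = inj₂ (sym x≈0)
  ... | tri> _ _ 0<x = inj₁ 0<x

  0≤⇒≮ : ∀ {x} → 0# ≤ x → ¬ (x < 0#)
  0≤⇒≮ (inj₁ 0<x) x<0 = irrefl refl (<-trans 0<x x<0)
  0≤⇒≮ (inj₂ 0≈x) x<0 = irrefl (sym 0≈x) x<0

  0≤-antisym : ∀ {x} → 0# ≤ x → 0# ≤ - x → x ≈ 0#
  0≤-antisym (inj₂ 0≈x) _    = sym 0≈x
  0≤-antisym (inj₁ 0<x) 0≤-x =
    ⊥-elim (0≤⇒≮ 0≤-x (0<-x⇒x<0 (<-respʳ-≈ (solve 1 (λ x → x := :- (:- x)) refl _) 0<x)))

  *-pos-neg : ∀ {x y} → 0# < x → y < 0# → x * y < 0#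
  *-pos-neg {x} {y} 0<x y<0 = 0<-x⇒x<0 (<-respʳ-≈
    (solve 2 (λ x y → x :* :- y := :- (x :* y)) refl x y) (*-pos 0<x (x<0⇒0<-x y<0)))

  *-cancelˡ-nonneg : ∀ {x y} → 0# < x → 0# ≤ x * y → 0# ≤ y
  *-cancelˡ-nonneg 0<x 0≤xy = ≮⇒0≤ λ y<0 → 0≤⇒≮ 0≤xy (*-pos-neg 0<x y<0)

  pos⇒≉0 : ∀ {x} → 0# < x → ¬ (x ≈ 0#)
  pos⇒≉0 0<x x≈0 = irrefl (sym x≈0) 0<x

  x*x-pos : ∀ {x} → ¬ (x ≈ 0#) → 0# < x * x
  x*x-pos {x} x≉0 with compare x 0#
  ... | tri< x<0 _ _ = <-respʳ-≈ (solve 1 (λ x → :- x :* :- x := x :* x) refl x)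
                         (*-pos (x<0⇒0<-x x<0) (x<0⇒0<-x x<0))
  ... | tri≈ _ x≈0 _ = ⊥-elim (x≉0 x≈0)
  ... | tri> _ _ 0<x = *-pos 0<x 0<x

  x*x-nonneg : ∀ x → 0# ≤ x * x
  x*x-nonneg x with compare x 0#
  ... | tri< _ x≉0 _ = inj₁ (x*x-pos x≉0)
  ... | tri≈ _ x≈0 _ = inj₂ (sym (trans (*-congʳ x≈0) (zeroˡ x)))
  ... | tri> _ x≉0 _ = inj₁ (x*x-pos x≉0)

  0<1 : 0# < 1#
  0<1 = <-respʳ-≈ (*-identityˡ 1#) (x*x-pos (0≉1 ∘ sym))

  *-≉0 : ∀ {x y} → ¬ (x ≈ 0#) → ¬ (y ≈ 0#) → ¬ (x * y ≈ 0#)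
  *-≉0 {x} {y} x≉0 y≉0 xy≈0 = pos⇒≉0 (*-pos (x*x-pos x≉0) (x*x-pos y≉0)) (begin
    (x * x) * (y * y) ≈⟨ solve 2 (λ x y → (x :* x) :* (y :* y) := (x :* y) :* (x :* y)) refl x y ⟩
    (x * y) * (x * y) ≈⟨ *-congʳ xy≈0 ⟩
    0# * (x * y)      ≈⟨ zeroˡ _ ⟩
    0#                ∎)
    where open SetoidReasoning setoid

  inverse-pos : ∀ {x y} → 0# < x → x * y ≈ 1# → 0# < y
  inverse-pos {x} {y} 0<x xy≈1 with *-cancelˡ-nonneg {y = y} 0<x (inj₁ (<-respʳ-≈ (sym xy≈1) 0<1))
  ... | inj₁ 0<y = 0<y
  ... | inj₂ 0≈y = ⊥-elim (0≉1 (trans (sym (zeroʳ x)) (trans (*-congˡ 0≈y) xy≈1)))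

  upperBound : ∀ x y → ∃[ m ] x ≤ m × y ≤ m
  upperBound x y with compare x y
  ... | tri< x<y _ _ = y , inj₁ x<y , inj₂ refl
  ... | tri≈ _ x≈y _ = y , inj₂ x≈y , inj₂ refl
  ... | tri> _ _ y<x = x , inj₂ refl , inj₁ y<x

  0<⇒≤⇒0< : ∀ {x y} → 0# < x → x ≤ y → 0# < y
  0<⇒≤⇒0< 0<x (inj₁ x<y) = <-trans 0<x x<y
  0<⇒≤⇒0< 0<x (inj₂ x≈y) = <-respʳ-≈ x≈y 0<x

  -- If α = - δ < 0 and M > 0 bounds β and γ, then ε = δ / (δ + 2M) makes the
  -- quadratic negative.
  limit-nonneg : ∀ α β γ → (∀ ε → 0# < ε → 0# ≤ α + ε * β + ε * ε * γ) → 0# ≤ α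
  limit-nonneg α β γ nonneg = ≮⇒0≤ λ α<0 → negative α<0
    where
    open SetoidReasoning setoid
    negative : ¬ (α < 0#)
    negative α<0 =
      let N , β≤N , γ≤N = upperBound β γ
          M , 1≤M , N≤M = upperBound 1# N
          0<M = 0<⇒≤⇒0< 0<1 1≤M
          bound : ∀ {x} → x ≤ N → 0# ≤ M + - x
          bound {x} x≤N = case ≤⇒0≤- x≤N of λ
            { (inj₁ 0<N-x) → ≤-resp-≈ (solve 3 (λ M N x → (N :+ :- x) :+ (M :+ :- N) := M :+ :- x) refl M N x)
                               (inj₁ (+-pos-nonneg 0<N-x (≤⇒0≤- N≤M)))
            ; (inj₂ 0≈N-x) → ≤-resp-≈ (trans (sym (+-identityʳ _)) (trans (+-congˡ 0≈N-x)
                 (solve 3 (λ M N x → (M :+ :- N) :+ (N :+ :- x) := M :+ :- x) refl M N x))) (≤⇒0≤- N≤M) }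
          δ = - α
          0<δ = x<0⇒0<-x α<0
          0<δ+2M = +-pos 0<δ (+-pos 0<M 0<M)
          w , δ+2M*w≈1 = inverse (δ + (M + M)) (pos⇒≉0 0<δ+2M)
          0<w = inverse-pos 0<δ+2M δ+2M*w≈1
          ε = δ * w
          0<ε = *-pos 0<δ 0<w
          -- This is minus the quadratic at ε, because (δ + 2M) w = 1.
          positive : 0# < δ * ε + ε * M * ((M + M) * w) + ε * (M + - β) + ε * ε * (M + - γ)
          positive = +-pos-nonneg (+-pos-nonneg
            (+-pos (*-pos 0<δ 0<ε) (*-pos (*-pos 0<ε 0<M) (*-pos (+-pos 0<M 0<M) 0<w)))
            (*-pos-nonneg 0<ε (bound β≤N))) (*-pos-nonneg (*-pos 0<ε 0<ε) (bound γ≤N))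
      in 0≤⇒≮ (nonneg ε 0<ε) (0<-x⇒x<0 (<-respʳ-≈ (begin
        δ * ε + ε * M * ((M + M) * w) + ε * (M + - β) + ε * ε * (M + - γ)
          ≈⟨ solve 5 (λ α β γ M w →
               let δ = :- α ; ε = δ :* w ; u = (δ :+ (M :+ M)) :* w in
               δ :* ε :+ ε :* M :* ((M :+ M) :* w) :+ ε :* (M :+ :- β) :+ ε :* ε :* (M :+ :- γ) :=
               u :* (δ :+ M :* ε) :+ :- (M :* ε :+ ε :* β :+ ε :* ε :* γ)) refl α β γ M w ⟩
        (δ + (M + M)) * w * (δ + M * ε) + - (M * ε + ε * β + ε * ε * γ)
          ≈⟨ +-congʳ (*-congʳ δ+2M*w≈1) ⟩
        1# * (δ + M * ε) + - (M * ε + ε * β + ε * ε * γ)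
          ≈⟨ solve 5 (λ α β γ M ε →
               con (+ 1) :* (:- α :+ M :* ε) :+ :- (M :* ε :+ ε :* β :+ ε :* ε :* γ) :=
               :- (α :+ ε :* β :+ ε :* ε :* γ)) refl α β γ M ε ⟩
        - (α + ε * β + ε * ε * γ) ∎) positive))

  -- Dividing by the absolute value of `t` and letting `t` tend to zero gives `u ≥ 0` from the right
  -- and `- u ≥ 0` from the left.
  nonneg⇒linear-term≈0 : ∀ u v → (∀ t → 0# ≤ t * u + t * t * v) → u ≈ 0#
  nonneg⇒linear-term≈0 u v nonneg = 0≤-antisym
    (limit-nonneg u v 0# λ ε 0<ε → *-cancelˡ-nonneg 0<ε (≤-resp-≈
      (solve 3 (λ ε u v → ε :* u :+ ε :* ε :* v := ε :* (u :+ ε :* v :+ ε :* ε :* con (+ 0))) refl ε u v)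
      (nonneg ε)))
    (limit-nonneg (- u) v 0# λ ε 0<ε → *-cancelˡ-nonneg 0<ε (≤-resp-≈
      (solve 3 (λ ε u v → :- ε :* u :+ :- ε :* :- ε :* v :=
                          ε :* (:- u :+ ε :* v :+ ε :* ε :* con (+ 0))) refl ε u v)
      (nonneg (- ε))))

  module _ (α β γ : Carrier) (nonneg : ∀ t → 0# ≤ α + t * β + t * t * γ) where
    private
      reversed-≉0 : ∀ t → ¬ (t ≈ 0#) → 0# ≤ γ + t * β + t * t * α
      reversed-≉0 t t≉0 =
        let w , tw≈1 = inverse t t≉0 in
        ≤-resp-≈ (begin
          t * t * (α + w * β + w * w * γ)
            ≈⟨ solve 5 (λ α β γ t w → t :* t :* (α :+ w :* β :+ w :* w :* γ) :=
                 t :* w :* (t :* w) :* γ :+ t :* (t :* w) :* β :+ t :* t :* α) refl α β γ t w ⟩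
          t * w * (t * w) * γ + t * (t * w) * β + t * t * α
            ≈⟨ +-congʳ (+-cong (*-congʳ (*-cong tw≈1 tw≈1)) (*-congʳ (*-congˡ tw≈1))) ⟩
          1# * 1# * γ + t * 1# * β + t * t * α
            ≈⟨ solve 4 (λ α β γ t → con (+ 1) :* con (+ 1) :* γ :+ t :* con (+ 1) :* β :+ t :* t :* α :=
                                    γ :+ t :* β :+ t :* t :* α) refl α β γ t ⟩
          γ + t * β + t * t * α ∎)
        (*-pos-nonneg (x*x-pos t≉0) (nonneg w))
        where open SetoidReasoning setoid

    -- For nonzero `t` this is `t * t` times the original quadratic at `1 / t`; the value at zero is
    -- a limit from the right.
    reversed-nonneg : ∀ t → 0# ≤ γ + t * β + t * t * α
    reversed-nonneg t with compare t 0#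
    ... | tri< _ t≉0 _ = reversed-≉0 t t≉0
    ... | tri≈ _ t≈0 _ = ≤-resp-≈
      (trans (solve 3 (λ α β γ → γ := γ :+ con (+ 0) :* β :+ con (+ 0) :* con (+ 0) :* α) refl α β γ)
        (sym (+-cong (+-congˡ (*-congʳ t≈0)) (*-congʳ (*-cong t≈0 t≈0)))))
      (limit-nonneg γ β α λ ε 0<ε → reversed-≉0 ε (pos⇒≉0 0<ε))
    ... | tri> _ t≉0 _ = reversed-≉0 t t≉0

-- Sign conditions on the upper half-plane and their passage to the boundary

module HalfPlane {c ℓ₁ ℓ₂} (ℝ : RealNumbers c ℓ₁ ℓ₂) where
  open RealNumbers ℝ
  open CommutativeRing commutativeRing
    using (refl; sym; trans; setoid; +-comm; +-cong; +-congˡ; +-congʳ; *-cong; *-congˡ; -‿cong)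
  open IsStrictTotalOrder isStrictTotalOrder
    using (irrefl; <-respʳ-≈)
  open IntegerSolver commutativeRing
  open OrderedField ℝ

  ℂ : Set c
  ℂ = Complex ℝ

  open Complex {ℝ = ℝ}
  open RawRing (complexRing ℝ) using ()
    renaming (_≈_ to _≈ᶜ_; _+_ to _+ᶜ_; _*_ to _*ᶜ_; 0# to 0ᶜ)

  complexCommutativeRing : CommutativeRing c ℓ₁
  complexCommutativeRing = record
    { RawRing (complexRing ℝ)
    ; isCommutativeRing = record
      { isRing = record
        { +-isAbelianGroup = record
          { isGroup = record
            { isMonoid = record
              { isSemigroup = record
                { isMagma = record
                  { isEquivalence = record
                    { refl  = refl , refl
                    ; sym   = λ (p , q) → sym p , sym q
                    ; trans = λ (p , q) (r , s) → trans p r , trans q s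
                    }
                  ; ∙-cong = λ (p , q) (r , s) → +-cong p r , +-cong q s
                  }
                ; assoc = λ z w v → R.+-assoc _ _ _ , R.+-assoc _ _ _
                }
              ; identity = (λ _ → R.+-identityˡ _ , R.+-identityˡ _) , (λ _ → R.+-identityʳ _ , R.+-identityʳ _)
              }
            ; inverse = (λ _ → R.-‿inverseˡ _ , R.-‿inverseˡ _) , (λ _ → R.-‿inverseʳ _ , R.-‿inverseʳ _)
            ; ⁻¹-cong = λ (p , q) → -‿cong p , -‿cong q
            }
          ; comm = λ _ _ → R.+-comm _ _ , R.+-comm _ _
          }
        ; *-cong = λ (p , q) (r , s) →
            +-cong (*-cong p r) (-‿cong (*-cong q s)) , +-cong (*-cong p s) (*-cong q r)
        ; *-assoc = λ (a +i b) (c +i d) (e +i f) →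
            solve 6 (λ a b c d e f →
              (a :* c :+ :- (b :* d)) :* e :+ :- ((a :* d :+ b :* c) :* f) :=
              a :* (c :* e :+ :- (d :* f)) :+ :- (b :* (c :* f :+ d :* e))) refl a b c d e f ,
            solve 6 (λ a b c d e f →
              (a :* c :+ :- (b :* d)) :* f :+ (a :* d :+ b :* c) :* e :=
              a :* (c :* f :+ d :* e) :+ b :* (c :* e :+ :- (d :* f))) refl a b c d e f
        ; *-identity =
            (λ (a +i b) →
              solve 2 (λ a b → con (+ 1) :* a :+ :- (con (+ 0) :* b) := a) refl a b ,
              solve 2 (λ a b → con (+ 1) :* b :+ con (+ 0) :* a := b) refl a b) ,
            (λ (a +i b) →
              solve 2 (λ a b → a :* con (+ 1) :+ :- (b :* con (+ 0)) := a) refl a b ,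
              solve 2 (λ a b → a :* con (+ 0) :+ b :* con (+ 1) := b) refl a b)
        ; distrib =
            (λ (a +i b) (c +i d) (e +i f) →
              solve 6 (λ a b c d e f →
                a :* (c :+ e) :+ :- (b :* (d :+ f)) :=
                (a :* c :+ :- (b :* d)) :+ (a :* e :+ :- (b :* f))) refl a b c d e f ,
              solve 6 (λ a b c d e f →
                a :* (d :+ f) :+ b :* (c :+ e) :=
                (a :* d :+ b :* c) :+ (a :* f :+ b :* e)) refl a b c d e f) ,
            (λ (a +i b) (c +i d) (e +i f) →
              solve 6 (λ a b c d e f →
                (c :+ e) :* a :+ :- ((d :+ f) :* b) :=
                (c :* a :+ :- (d :* b)) :+ (e :* a :+ :- (f :* b))) refl a b c d e f ,
              solve 6 (λ a b c d e f →
                (c :+ e) :* b :+ (d :+ f) :* a :=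
                (c :* b :+ d :* a) :+ (e :* b :+ f :* a)) refl a b c d e f)
        }
      ; *-comm = λ (a +i b) (c +i d) →
          solve 4 (λ a b c d → a :* c :+ :- (b :* d) := c :* a :+ :- (d :* b)) refl a b c d ,
          solve 4 (λ a b c d → a :* d :+ b :* c := c :* b :+ d :* a) refl a b c d
      }
    }
    where module R = CommutativeRing commutativeRing

  module C = CommutativeRing complexCommutativeRing
  open Evaluation complexCommutativeRing

  evalᶜ : Multiaffine (complexRing ℝ) n → Functional.Vector ℂ n → ℂ
  evalᶜ = eval (complexRing ℝ)

  -- For nonzero `r` this has the sign of the imaginary part of `p / r`, but it involves no
  -- division.
  Im[_*conj_] : ℂ → ℂ → Carrier
  Im[ p *conj r ] = im p * re r + - (re p * im r)

  Re[_*conj_] : ℂ → ℂ → Carrier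
  Re[ p *conj r ] = re p * re r + im p * im r

  Im-cong : ∀ {p p′ r r′} → p ≈ᶜ p′ → r ≈ᶜ r′ → Im[ p *conj r ] ≈ Im[ p′ *conj r′ ]
  Im-cong (a , b) (c , d) = +-cong (*-cong b c) (-‿cong (*-cong a d))

  -- The terms are grouped by powers of `v`, and the group free of `v` is the value at the real
  -- point `u`; in this form `limit-nonneg` applies.
  Im-expand : ∀ p q r s u v → Im[ p +ᶜ (u +i v) *ᶜ q *conj r +ᶜ (u +i v) *ᶜ s ] ≈
    (Im[ p *conj r ] + u * (Im[ p *conj s ] + Im[ q *conj r ]) + u * u * Im[ q *conj s ])
      + v * (Re[ q *conj r ] + - Re[ p *conj s ]) + v * v * Im[ q *conj s ]
  Im-expand (a +i b) (c +i d) (e +i f) (g +i h) u v =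
    solve 10 (λ a b c d e f g h u v →
      let Im : ∀ {n} → (w x y z : Polynomial n) → Polynomial n
          Im w x y z = x :* y :+ :- (w :* z)
          Re : ∀ {n} → (w x y z : Polynomial n) → Polynomial n
          Re w x y z = w :* y :+ x :* z
      in Im (a :+ (u :* c :+ :- (v :* d))) (b :+ (u :* d :+ v :* c))
            (e :+ (u :* g :+ :- (v :* h))) (f :+ (u :* h :+ v :* g)) :=
         (Im a b e f :+ u :* (Im a b g h :+ Im c d e f) :+ u :* u :* Im c d g h)
           :+ v :* (Re c d e f :+ :- Re a b g h) :+ v :* v :* Im c d g h)
      refl a b c d e f g h u v

  Im-expand-real : ∀ p q r s u → Im[ p +ᶜ (u +i 0#) *ᶜ q *conj r +ᶜ (u +i 0#) *ᶜ s ] ≈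
    Im[ p *conj r ] + u * (Im[ p *conj s ] + Im[ q *conj r ]) + u * u * Im[ q *conj s ]
  Im-expand-real p q r s u = trans (Im-expand p q r s u 0#)
    (solve 3 (λ x y z → x :+ con (+ 0) :* y :+ con (+ 0) :* con (+ 0) :* z := x) refl _ _ _)

  -- Substitution of a point of the real projective line for the first variable,
  -- in the affine chart with the vertex x at t = 0: the value is t if x is
  -- outside, and 1 / t, with the polynomial multiplied by t, if x is inside.
  chart : Bool → Carrier → (Subset (suc n) → Carrier) → Subset n → Carrier
  chart x t f S = f (x ∷ S) + t * f (not x ∷ S)

  module _ {p q r s : ℂ}
           (nonneg : ∀ u v → 0# < v → 0# ≤ Im[ p +ᶜ (u +i v) *ᶜ q *conj r +ᶜ (u +i v) *ᶜ s ]) where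

    boundary-nonneg : ∀ t → 0# ≤ Im[ p +ᶜ (t +i 0#) *ᶜ q *conj r +ᶜ (t +i 0#) *ᶜ s ]
    boundary-nonneg t = ≤-resp-≈ (sym (Im-expand-real p q r s t)) $
      limit-nonneg _ _ _ λ ε 0<ε → ≤-resp-≈ (Im-expand p q r s t ε) (nonneg t ε 0<ε)

    -- Exchanging `p` with `q` and `r` with `s` reverses the coefficients of the quadratic in `t`,
    -- so `reversed-nonneg` settles the chart around infinity.
    boundary-nonneg-∞ : ∀ t → 0# ≤ Im[ q +ᶜ (t +i 0#) *ᶜ p *conj s +ᶜ (t +i 0#) *ᶜ r ]
    boundary-nonneg-∞ t = ≤-resp-≈
      (trans (+-congʳ (+-congˡ (*-congˡ (+-comm _ _))))
             (sym (Im-expand-real q p s r t)))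
      (reversed-nonneg _ _ _ (λ t → ≤-resp-≈ (Im-expand-real p q r s t) (boundary-nonneg t)) t)

  -- Real and imaginary parts stay separate real families because a real substitution acts on each
  -- of them by the same `chart`.
  _⊕i_ : (a b : Subset n → Carrier) → Subset n → ℂ
  (a ⊕i b) S = a S +i b S

  UpperHalf : Functional.Vector ℂ n → Set ℓ₂
  UpperHalf z = ∀ i → 0# < im (z i)

  -- That is, P / Q maps the product of upper half-planes to the closed upper
  -- half-plane.
  record Herglotz (P Q : Subset n → ℂ) : Set (c ⊔ ℓ₁ ⊔ ℓ₂) where
    constructor herglotz
    field
      Im-nonneg : ∀ z → UpperHalf z → 0# ≤ Im[ evalᶜ P z *conj evalᶜ Q z ]

  Herglotz-cong : {P P′ Q Q′ : Subset n → ℂ} → (∀ S → P S ≈ᶜ P′ S) → (∀ S → Q S ≈ᶜ Q′ S) →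
                  Herglotz P Q → Herglotz P′ Q′
  Herglotz-cong P≈P′ Q≈Q′ (herglotz H) = herglotz λ z z∈ →
    ≤-resp-≈ (Im-cong (eval-cong z P≈P′) (eval-cong z Q≈Q′)) (H z z∈)

  eval-chart : ∀ x t (a b : Subset (suc n) → Carrier) z →
    evalᶜ (chart x t a ⊕i chart x t b) z ≈ᶜ
    evalᶜ ((a ⊕i b) ∘ (x ∷_)) z +ᶜ (t +i 0#) *ᶜ evalᶜ ((a ⊕i b) ∘ (not x ∷_)) z
  eval-chart {n} x t a b z = C.trans
    (eval-cong {n} z λ S →
      solve 4 (λ t x y y′ → x :+ t :* y := x :+ (t :* y :+ :- (con (+ 0) :* y′))) refl
        t (a (x ∷ S)) (a (not x ∷ S)) (b (not x ∷ S)) ,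
      solve 4 (λ t x y y′ → x :+ t :* y := x :+ (t :* y :+ con (+ 0) :* y′)) refl
        t (b (x ∷ S)) (b (not x ∷ S)) (a (not x ∷ S)))
    (eval-linear (t +i 0#) ((a ⊕i b) ∘ (x ∷_)) ((a ⊕i b) ∘ (not x ∷_)) z)

  UpperHalf-∷ : ∀ {w} {z : Functional.Vector ℂ n} → 0# < im w → UpperHalf z → UpperHalf (w Functional.∷ z)
  UpperHalf-∷ 0<w z∈ zero    = 0<w
  UpperHalf-∷ 0<w z∈ (suc i) = z∈ i

  -- With the other variables fixed in the upper half-plane, both polynomials are affine in the
  -- first one, and the boundary lemmas apply to their four complex coefficients.
  Herglotz-chart : ∀ (a b c d : Subset (suc n) → Carrier) x t → Herglotz (a ⊕i b) (c ⊕i d) →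
    Herglotz (chart x t a ⊕i chart x t b) (chart x t c ⊕i chart x t d)
  Herglotz-chart {n} a b c d x t (herglotz H) = herglotz λ z z∈ →
    ≤-resp-≈ (sym (Im-cong (eval-chart x t a b z) (eval-chart x t c d z))) (boundary z z∈ x)
    where
    module _ (z : Functional.Vector ℂ n) (z∈ : UpperHalf z) where
      interior : ∀ u v → 0# < v → 0# ≤
        Im[ evalᶜ ((a ⊕i b) ∘ (outside ∷_)) z +ᶜ (u +i v) *ᶜ evalᶜ ((a ⊕i b) ∘ (inside ∷_)) z *conj
            evalᶜ ((c ⊕i d) ∘ (outside ∷_)) z +ᶜ (u +i v) *ᶜ evalᶜ ((c ⊕i d) ∘ (inside ∷_)) z ]
      interior u v 0<v = ≤-resp-≈
        (Im-cong (eval-suc (a ⊕i b) ((u +i v) Functional.∷ z)) (eval-suc (c ⊕i d) ((u +i v) Functional.∷ z)))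
        (H ((u +i v) Functional.∷ z) (UpperHalf-∷ 0<v z∈))
      boundary : ∀ x → 0# ≤
        Im[ evalᶜ ((a ⊕i b) ∘ (x ∷_)) z +ᶜ (t +i 0#) *ᶜ evalᶜ ((a ⊕i b) ∘ (not x ∷_)) z *conj
            evalᶜ ((c ⊕i d) ∘ (x ∷_)) z +ᶜ (t +i 0#) *ᶜ evalᶜ ((c ⊕i d) ∘ (not x ∷_)) z ]
      boundary outside = boundary-nonneg interior t
      boundary inside  = boundary-nonneg-∞ interior t

  -- An entry is a point of the real projective line in the sense of `chart`: the vertex at its
  -- centre and the parameter there.
  ev : (Subset n → Carrier) → Vec (Bool × Carrier) n → Carrier
  ev f []            = f []
  ev f ((x , t) ∷ w) = ev (chart x t f) w

  -- When no variable is left, the families are single numbers and the expression is the imaginary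
  -- part of (a + i b)(c - i d).
  Herglotz-boundary : ∀ (a b c d : Subset n → Carrier) → Herglotz (a ⊕i b) (c ⊕i d) → ∀ w →
    0# ≤ ev b w * ev c w + - (ev a w * ev d w)
  Herglotz-boundary a b c d (herglotz H) [] =
    ≤-resp-≈ (Im-cong (C.*-identityʳ ((a ⊕i b) [])) (C.*-identityʳ ((c ⊕i d) []))) (H Functional.[] λ ())
  Herglotz-boundary a b c d H ((x , t) ∷ w) =
    Herglotz-boundary _ _ _ _ (Herglotz-chart a b c d x t H) w

  -- For real families this is multivariate interlacing, also called proper position.
  Interlacing : (g h : Subset n → Carrier) → Set (c ⊔ ℓ₁ ⊔ ℓ₂)
  Interlacing g h = Herglotz (λ S → g S +i 0#) (λ S → h S +i 0#)

  Interlacing-chart : ∀ {g h : Subset (suc n) → Carrier} x t →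
    Interlacing g h → Interlacing (chart x t g) (chart x t h)
  Interlacing-chart {g = g} {h} x t H = Herglotz-cong
    (λ S → refl , solve 1 (λ t → con (+ 0) :+ t :* con (+ 0) := con (+ 0)) refl t)
    (λ S → refl , solve 1 (λ t → con (+ 0) :+ t :* con (+ 0) := con (+ 0)) refl t)
    (Herglotz-chart g (λ _ → 0#) h (λ _ → 0#) x t H)

  -- With the first variable at the imaginary unit, the two restrictions of `g` become its real and
  -- imaginary parts, and likewise for `h`; the remaining variables then go to the boundary.
  Interlacing-wronskian : ∀ {g h : Subset (suc n) → Carrier} → Interlacing g h → ∀ w →
    0# ≤ ev (g ∘ (inside ∷_)) w * ev (h ∘ (outside ∷_)) w +
         - (ev (g ∘ (outside ∷_)) w * ev (h ∘ (inside ∷_)) w)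
  Interlacing-wronskian {n} {g} {h} (herglotz H) = Herglotz-boundary _ _ _ _ $ herglotz λ z z∈ →
    ≤-resp-≈ (Im-cong (at-i g z) (at-i h z)) (H ((0# +i 1#) Functional.∷ z) (UpperHalf-∷ 0<1 z∈))
    where
    at-i : ∀ (f : Subset (suc n) → Carrier) z → evalᶜ (λ S → f S +i 0#) ((0# +i 1#) Functional.∷ z) ≈ᶜ
                 evalᶜ ((f ∘ (outside ∷_)) ⊕i (f ∘ (inside ∷_))) z
    at-i f z = C.trans (eval-suc (λ S → f S +i 0#) ((0# +i 1#) Functional.∷ z)) (C.sym (C.trans
      (eval-cong {n} z λ S →
        solve 2 (λ x y → x := x :+ (con (+ 0) :* y :+ :- (con (+ 1) :* con (+ 0)))) refl
          (f (outside ∷ S)) (f (inside ∷ S)) ,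
        solve 1 (λ y → y := con (+ 0) :+ (con (+ 0) :* con (+ 0) :+ con (+ 1) :* y)) refl (f (inside ∷ S)))
      (eval-linear (0# +i 1#) (λ S → f (outside ∷ S) +i 0#) (λ S → f (inside ∷ S) +i 0#) z)))

  -- The zero is - p / r, written with `w` as the inverse of the squared modulus of `r`; its
  -- imaginary part is minus the given negative quantity times `w`. Strictness excludes that `r` is
  -- zero.
  root : ∀ p r → Im[ p *conj r ] < 0# → ∃[ ζ ] 0# < im ζ × p +ᶜ ζ *ᶜ r ≈ᶜ 0ᶜ
  root (a +i b) (c +i d) Im<0 =
    let w , Nw≈1 = inverse (c * c + d * d) (pos⇒≉0 0<N)
        0<w = inverse-pos 0<N Nw≈1
    in (- (a * c + b * d) * w) +i (- (b * c + - (a * d)) * w) ,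
       *-pos (x<0⇒0<-x Im<0) 0<w ,
       (begin
         a + (- (a * c + b * d) * w * c + - (- (b * c + - (a * d)) * w * d))
           ≈⟨ solve 5 (λ a b c d w →
                a :+ (:- (a :* c :+ b :* d) :* w :* c :+ :- (:- (b :* c :+ :- (a :* d)) :* w :* d)) :=
                a :+ :- (a :* ((c :* c :+ d :* d) :* w))) refl a b c d w ⟩
         a + - (a * ((c * c + d * d) * w)) ≈⟨ cancel a Nw≈1 ⟩
         0# ∎) ,
       (begin
         b + (- (a * c + b * d) * w * d + - (b * c + - (a * d)) * w * c)
           ≈⟨ solve 5 (λ a b c d w →
                b :+ (:- (a :* c :+ b :* d) :* w :* d :+ :- (b :* c :+ :- (a :* d)) :* w :* c) :=
                b :+ :- (b :* ((c :* c :+ d :* d) :* w))) refl a b c d w ⟩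
         b + - (b * ((c * c + d * d) * w)) ≈⟨ cancel b Nw≈1 ⟩
         0# ∎)
    where
    open SetoidReasoning setoid
    cancel : ∀ x {u} → u ≈ 1# → x + - (x * u) ≈ 0#
    cancel x u≈1 = trans (+-congˡ (-‿cong (*-congˡ u≈1)))
      (solve 1 (λ x → x :+ :- (x :* con (+ 1)) := con (+ 0)) refl x)
    Im≈0 : c ≈ 0# → d ≈ 0# → b * c + - (a * d) ≈ 0#
    Im≈0 c≈0 d≈0 = trans (+-cong (*-congˡ c≈0) (-‿cong (*-congˡ d≈0)))
      (solve 2 (λ a b → b :* con (+ 0) :+ :- (a :* con (+ 0)) := con (+ 0)) refl a b)
    0<N : 0# < c * c + d * d
    0<N with compare c 0# | compare d 0#
    ... | tri≈ _ c≈0 _ | tri≈ _ d≈0 _ = ⊥-elim (irrefl (Im≈0 c≈0 d≈0) Im<0)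
    ... | tri< _ c≉0 _ | _ = +-pos-nonneg (x*x-pos c≉0) (x*x-nonneg d)
    ... | tri> _ c≉0 _ | _ = +-pos-nonneg (x*x-pos c≉0) (x*x-nonneg d)
    ... | tri≈ _ _ _ | tri< _ d≉0 _ = <-respʳ-≈ (+-comm _ _) (+-pos-nonneg (x*x-pos d≉0) (x*x-nonneg c))
    ... | tri≈ _ _ _ | tri> _ d≉0 _ = <-respʳ-≈ (+-comm _ _) (+-pos-nonneg (x*x-pos d≉0) (x*x-nonneg c))

  UpperHalf-insertAt : ∀ {z : Functional.Vector ℂ n} i {w} → 0# < im w → UpperHalf z →
                       UpperHalf (Functional.insertAt z i w)
  UpperHalf-insertAt zero 0<w z∈ zero = 0<w
  UpperHalf-insertAt zero 0<w z∈ (suc j) = z∈ j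
  UpperHalf-insertAt {suc n} (suc i) 0<w z∈ zero = z∈ zero
  UpperHalf-insertAt {suc n} (suc i) 0<w z∈ (suc j) = UpperHalf-insertAt i 0<w (z∈ ∘ suc) j

  stable⇒Interlacing : ∀ (f : Subset (suc n) → Carrier) → RealStable ℝ f → ∀ i →
    Interlacing (λ S → f (insertAt S i outside)) (λ S → f (insertAt S i inside))
  stable⇒Interlacing f stable i = herglotz λ z z∈ → ≮⇒0≤ λ Im<0 →
    let ζ , 0<ζ , root≈0 = root _ _ Im<0 in
    stable (Functional.insertAt z i ζ) (UpperHalf-insertAt i 0<ζ z∈)
      (C.trans (eval-insertAt (λ S → f S +i 0#) i z ζ) root≈0)

-- Exchange and signs

module Exchange {c ℓ₁ ℓ₂} (ℝ : RealNumbers c ℓ₁ ℓ₂) where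
  open RealNumbers ℝ
  open CommutativeRing commutativeRing
    using (refl; sym; trans; reflexive; setoid; +-cong; +-congˡ; +-congʳ; *-cong; *-congˡ;
           -‿cong; +-identityˡ; +-identityʳ; zeroˡ; zeroʳ)
  open IsStrictTotalOrder isStrictTotalOrder using (_≟_)
  open IntegerSolver commutativeRing
  open OrderedField ℝ
  open HalfPlane ℝ

  chart-0 : ∀ x (f : Subset (suc n) → Carrier) S → chart x 0# f S ≈ f (x ∷ S)
  chart-0 x f S = trans (+-congˡ (zeroˡ _)) (+-identityʳ _)

  -- With every parameter zero a single coefficient survives. The point is chosen before `F`, so
  -- that one point serves all restrictions of `g` and `h` occurring in the same inequality.
  vertex : ∀ (X : Subset n) → ∃[ w ] ∀ F → ev F w ≈ F X
  vertex []      = [] , λ F → refl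
  vertex (x ∷ X) = let w , eq = vertex X in
    (x , 0#) ∷ w , λ F → trans (eq (chart x 0# F)) (chart-0 x F X)

  -- All charts are centred at `X` and only the parameter in direction `j` is left free.
  edge : ∀ (X : Subset n) j t → ∃[ w ] ∀ F → ev F w ≈ F X + t * F (X △ ⁅ j ⁆)
  edge (x ∷ X) zero t = let w , eq = vertex X in
    (x , t) ∷ w , λ F → trans (eq (chart x t F))
      (+-congˡ (*-congˡ (reflexive (≡.cong F (≡.sym (△-⁅zero⁆ x X))))))
  edge (x ∷ X) (suc j) t = let w , eq = edge X j t in
    (x , 0#) ∷ w , λ F → trans (eq (chart x 0# F))
      (+-cong (chart-0 x F X) (*-congˡ (trans (chart-0 x F (X △ ⁅ j ⁆))
        (reflexive (≡.cong F (≡.sym (△-⁅suc⁆ x X j)))))))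

  -- The Wronskian inequality distinguishes the first variable, so the variables in front of `j` are
  -- removed beforehand at parameter zero.
  Interlacing-vertex : ∀ (g h : Subset (suc n) → Carrier) → Interlacing g h → ∀ j T →
    0# ≤ g (insertAt T j inside) * h (insertAt T j outside) + - (g (insertAt T j outside) * h (insertAt T j inside))
  Interlacing-vertex g h H zero T = let w , eq = vertex T in
    ≤-resp-≈ (+-cong (*-cong (eq _) (eq _)) (-‿cong (*-cong (eq _) (eq _)))) (Interlacing-wronskian H w)
  Interlacing-vertex g h H (suc j) (x ∷ T) =
    ≤-resp-≈ (+-cong (*-cong (chart-0 x g _) (chart-0 x h _)) (-‿cong (*-cong (chart-0 x g _) (chart-0 x h _))))
      (Interlacing-vertex (chart x 0# g) (chart x 0# h) (Interlacing-chart x 0# H) j T)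

  -- Which restriction of f to a value of xᵢ comes first depends on whether the
  -- basis X of the exchange property contains i.
  Interlacing⇄ : (g h : Subset n → Carrier) → Set (c ⊔ ℓ₁ ⊔ ℓ₂)
  Interlacing⇄ g h = Interlacing g h ⊎ Interlacing h g

  Interlacing⇄-chart : ∀ {g h : Subset (suc n) → Carrier} x t →
    Interlacing⇄ g h → Interlacing⇄ (chart x t g) (chart x t h)
  Interlacing⇄-chart x t (inj₁ H) = inj₁ (Interlacing-chart x t H)
  Interlacing⇄-chart x t (inj₂ H) = inj₂ (Interlacing-chart x t H)

  -- Swapping `g` with `h`, or the two values of the first variable, negates the Wronskian. What is
  -- recorded is that it keeps one sign at all points.
  Interlacing⇄-wronskian : ∀ {g h : Subset (suc n) → Carrier} x → Interlacing⇄ g h →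
    let D w = ev (g ∘ (x ∷_)) w * ev (h ∘ (not x ∷_)) w + - (ev (g ∘ (not x ∷_)) w * ev (h ∘ (x ∷_)) w)
    in (∀ w → 0# ≤ D w) ⊎ (∀ w → 0# ≤ - D w)
  Interlacing⇄-wronskian inside  (inj₁ H) = inj₁ (Interlacing-wronskian H)
  Interlacing⇄-wronskian outside (inj₂ H) = inj₁ λ w → ≤-resp-≈
    (solve 4 (λ a b c d → a :* b :+ :- (c :* d) := b :* a :+ :- (d :* c)) refl _ _ _ _) (Interlacing-wronskian H w)
  Interlacing⇄-wronskian outside (inj₁ H) = inj₂ λ w → ≤-resp-≈
    (solve 4 (λ a b c d → a :* b :+ :- (c :* d) := :- (c :* d :+ :- (a :* b))) refl _ _ _ _) (Interlacing-wronskian H w)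
  Interlacing⇄-wronskian inside  (inj₂ H) = inj₂ λ w → ≤-resp-≈
    (solve 4 (λ a b c d → a :* b :+ :- (c :* d) := :- (d :* c :+ :- (b :* a))) refl _ _ _ _) (Interlacing-wronskian H w)

  *-cancelˡ-≈0 : ∀ {x y} → ¬ (x ≈ 0#) → x * y ≈ 0# → y ≈ 0#
  *-cancelˡ-≈0 {y = y} x≉0 xy≈0 = decidable-stable (y ≟ 0#) λ y≉0 → *-≉0 x≉0 y≉0 xy≈0

  -- On the edge from `X` to `X △ ⁅ j ⁆` the restriction of `h` at `x` vanishes and the one at
  -- `not x` is `t * η`. The Wronskian therefore has no constant term, and keeping one sign forces
  -- its linear coefficient `γ * η` to vanish.
  Interlacing⇄-square : ∀ (g h : Subset (suc n) → Carrier) → Interlacing⇄ g h → ∀ x X j →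
    ¬ (g (x ∷ X) ≈ 0#) → h (x ∷ X) ≈ 0# → h (not x ∷ X) ≈ 0# → h (x ∷ (X △ ⁅ j ⁆)) ≈ 0# →
    h (not x ∷ (X △ ⁅ j ⁆)) ≈ 0#
  Interlacing⇄-square g h H x X j γ≉0 h00≈0 h10≈0 h01≈0 = *-cancelˡ-≈0 γ≉0 γη≈0
    where
    γ  = g (x ∷ X)
    γ′ = g (x ∷ (X △ ⁅ j ⁆))
    η  = h (not x ∷ (X △ ⁅ j ⁆))
    open SetoidReasoning setoid
    along : ∀ t → let w , _ = edge X j t in
      ev (g ∘ (x ∷_)) w * ev (h ∘ (not x ∷_)) w + - (ev (g ∘ (not x ∷_)) w * ev (h ∘ (x ∷_)) w)
        ≈ t * (γ * η) + t * t * (γ′ * η)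
    along t = let w , eq = edge X j t in begin
      ev (g ∘ (x ∷_)) w * ev (h ∘ (not x ∷_)) w + - (ev (g ∘ (not x ∷_)) w * ev (h ∘ (x ∷_)) w)
        ≈⟨ +-cong (*-cong (eq _) (trans (eq _) (+-congʳ h10≈0)))
             (-‿cong (*-congˡ (trans (eq _) (+-cong h00≈0 (*-congˡ h01≈0))))) ⟩
      (γ + t * γ′) * (0# + t * η) + - (ev (g ∘ (not x ∷_)) w * (0# + t * 0#))
        ≈⟨ solve 5 (λ t γ γ′ η e →
             (γ :+ t :* γ′) :* (con (+ 0) :+ t :* η) :+ :- (e :* (con (+ 0) :+ t :* con (+ 0))) :=
             t :* (γ :* η) :+ t :* t :* (γ′ :* η)) refl t γ γ′ η _ ⟩
      t * (γ * η) + t * t * (γ′ * η) ∎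
    γη≈0 : γ * η ≈ 0#
    γη≈0 with Interlacing⇄-wronskian x H
    ... | inj₁ nonneg = nonneg⇒linear-term≈0 _ _ λ t → ≤-resp-≈ (along t) (nonneg (proj₁ (edge X j t)))
    -- A nonpositive Wronskian is handled by negating both coefficients.
    ... | inj₂ nonneg = begin
      γ * η         ≈⟨ solve 1 (λ x → x := :- (:- x)) refl _ ⟩
      - (- (γ * η)) ≈⟨ -‿cong (nonneg⇒linear-term≈0 (- (γ * η)) (- (γ′ * η)) λ t →
                         ≤-resp-≈ (trans (-‿cong (along t))
                           (solve 3 (λ t u v → :- (t :* u :+ t :* t :* v) := t :* (:- u) :+ t :* t :* (:- v)) refl t _ _))
                           (nonneg (proj₁ (edge X j t)))) ⟩
      - 0#          ≈⟨ solve 0 (:- con (+ 0) := con (+ 0)) refl ⟩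
      0#            ∎

  -- One of 1 and -1 works: if `a + b` and `a - b` both vanished, so would twice `a`.
  nonzero-shift : ∀ {a} b → ¬ (a ≈ 0#) → ∃[ t ] ¬ (t ≈ 0#) × ¬ (a + t * b ≈ 0#)
  nonzero-shift {a} b a≉0 with (a + 1# * b) ≟ 0#
  ... | no  a+b≉0 = 1# , 0≉1 ∘ sym , a+b≉0
  ... | yes a+b≈0 = - 1# , (λ -1≈0 → 0≉1 (begin
      0#     ≈⟨ solve 0 (con (+ 0) := :- con (+ 0)) refl ⟩
      - 0#   ≈⟨ -‿cong -1≈0 ⟨
      - - 1# ≈⟨ solve 0 (:- (:- con (+ 1)) := con (+ 1)) refl ⟩
      1#     ∎)) ,
    λ a-b≈0 → *-≉0 (pos⇒≉0 (+-pos 0<1 0<1)) a≉0 (begin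
      (1# + 1#) * a                ≈⟨ solve 2 (λ a b → (con (+ 1) :+ con (+ 1)) :* a :=
                                        (a :+ con (+ 1) :* b) :+ (a :+ :- con (+ 1) :* b)) refl a b ⟩
      (a + 1# * b) + (a + - 1# * b) ≈⟨ +-cong a+b≈0 a-b≈0 ⟩
      0# + 0#                      ≈⟨ +-identityˡ 0# ⟩
      0#                           ∎)
    where open SetoidReasoning setoid

  -- In the application `g` and `h` restrict `f` to the value of the exchanged coordinate in the
  -- basis and to the opposite value. The induction replaces the first variable by a value at which
  -- the hypotheses persist.
  Interlacing⇄-exchange : ∀ (g h : Subset n → Carrier) → Interlacing⇄ g h → ∀ X Y →
    ¬ (g X ≈ 0#) → h X ≈ 0# → (∀ j → j ∈ X △ Y → h (X △ ⁅ j ⁆) ≈ 0#) → h Y ≈ 0#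
  Interlacing⇄-exchange g h H [] [] gX≉0 hX≈0 near = hX≈0
  Interlacing⇄-exchange {suc n} g h H (x ∷ X) (y ∷ Y) gX≉0 hX≈0 near = cases x y ≡.refl ≡.refl
    where
    near-suc : ∀ j → j ∈ X △ Y → h (x ∷ (X △ ⁅ j ⁆)) ≈ 0#
    near-suc j j∈ = trans (reflexive (≡.cong h (≡.sym (△-⁅suc⁆ x X j)))) (near (suc j) (there j∈))

    -- Parameter zero fixes the first coordinate at `x`, so no move in that direction enters.
    same : h (x ∷ Y) ≈ 0#
    same = trans (sym (chart-0 x h Y)) (Interlacing⇄-exchange (chart x 0# g) (chart x 0# h)
      (Interlacing⇄-chart x 0# H) X Y
      (λ eq → gX≉0 (trans (sym (chart-0 x g X)) eq))
      (trans (chart-0 x h X) hX≈0)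
      (λ j j∈ → trans (chart-0 x h _) (near-suc j j∈)))

    -- The parameter `t` keeps `g` nonzero at `X`, and `Interlacing⇄-square` makes `h` vanish near
    -- `X` on both sides. Induction annihilates `h (x ∷ Y) + t * h (not x ∷ Y)`, and `same` removes
    -- the first term.
    different : h (not x ∷ X) ≈ 0# → h (not x ∷ Y) ≈ 0#
    different h10≈0 =
      let t , t≉0 , g≉0 = nonzero-shift (g (not x ∷ X)) gX≉0
          cancel : ∀ {S} → h (x ∷ S) ≈ 0# → h (not x ∷ S) ≈ 0# → chart x t h S ≈ 0#
          cancel p q = trans (+-cong p (trans (*-congˡ q) (zeroʳ t))) (+-identityˡ 0#)
          chart≈0 = Interlacing⇄-exchange (chart x t g) (chart x t h) (Interlacing⇄-chart x t H) X Y g≉0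
            (cancel hX≈0 h10≈0)
            (λ j j∈ → cancel (near-suc j j∈)
              (Interlacing⇄-square g h H x X j gX≉0 hX≈0 h10≈0 (near-suc j j∈)))
      in *-cancelˡ-≈0 t≉0 (trans (sym (trans (+-congʳ same) (+-identityˡ _))) chart≈0)

    flipped : zero ∈ (x ∷ X) △ (y ∷ Y) → h (not x ∷ X) ≈ 0#
    flipped 0∈ = trans (reflexive (≡.cong h (≡.sym (△-⁅zero⁆ x X)))) (near zero 0∈)

    cases : ∀ x′ y′ → x ≡ x′ → y ≡ y′ → h (y ∷ Y) ≈ 0#
    cases true  true  ≡.refl ≡.refl = same
    cases false false ≡.refl ≡.refl = same
    cases true  false ≡.refl ≡.refl = different (flipped here)
    cases false true  ≡.refl ≡.refl = different (flipped here)

  module _ (f : Subset (suc n) → Carrier) (stable : RealStable ℝ f) (i : Fin (suc n)) where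

    restrictions-interlace : ∀ x → Interlacing⇄ (λ S → f (insertAt S i x)) (λ S → f (insertAt S i (not x)))
    restrictions-interlace false = inj₁ (stable⇒Interlacing f stable i)
    restrictions-interlace true  = inj₂ (stable⇒Interlacing f stable i)

    -- The choice of `i` itself is tried first and then all other indices, a finite search because
    -- equality with zero is decidable. If all fail, `Interlacing⇄-exchange` expels the second set
    -- from the support.
    exchange-insertAt : ∀ X Y x → ¬ (f (insertAt X i x) ≈ 0#) → ¬ (f (insertAt Y i (not x)) ≈ 0#) →
      ∃[ j ] j ∈ insertAt X i x △ insertAt Y i (not x) × ¬ (f (insertAt X i x △ (⁅ i ⁆ ∪ ⁅ j ⁆)) ≈ 0#)
    exchange-insertAt X Y x fX≉0 fY≉0 with f (insertAt X i (not x)) ≟ 0#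
    ... | no f≉0 = i , ∈-insertAt-△ x ,
      λ f≈0 → f≉0 (trans (reflexive (≡.cong f (≡.sym (insertAt-△-⁅⁆∪⁅⁆ X i x)))) f≈0)
      where
      ∈-insertAt-△ : ∀ x → i ∈ insertAt X i x △ insertAt Y i (not x)
      ∈-insertAt-△ x = lookup⇒[]= i _ (≡.trans (≡.cong (λ Z → lookup Z i) (insertAt-△ X Y i x (not x)))
        (≡.trans (insertAt-lookup (X △ Y) i _) (xor-not x)))
        where
        xor-not : ∀ x → x xor not x ≡ true
        xor-not true = ≡.refl
        xor-not false = ≡.refl
    ... | yes hX≈0 with Fin.any? (λ j → (j ∈? X △ Y) ×-dec ¬? (f (insertAt (X △ ⁅ j ⁆) i (not x)) ≟ 0#))
    ...   | yes (j , j∈ , f≉0) = punchIn i j ,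
      ≡.subst (punchIn i j ∈_) (≡.sym (insertAt-△ X Y i x (not x))) (∈-insertAt i _ j∈) ,
      λ f≈0 → f≉0 (trans (reflexive (≡.cong f (≡.sym (insertAt-△-⁅⁆∪⁅punchIn⁆ X i j x)))) f≈0)
    ...   | no none = contradiction
      (Interlacing⇄-exchange _ _ (restrictions-interlace x) X Y fX≉0 hX≈0 λ j j∈ →
        decidable-stable (_ ≟ 0#) λ f≉0 → none (j , j∈ , f≉0))
      fY≉0

-- Long edges of the polytope, signs of products, and the conditions on an orientation

module Orientation {c ℓ₁ ℓ₂} (ℝ : RealNumbers c ℓ₁ ℓ₂) where
  open RealNumbers ℝ
  open CommutativeRing commutativeRing
    using (refl; sym; trans; reflexive; setoid; +-comm; +-cong; +-congˡ; +-congʳ; *-congˡ; *-congʳ;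
           -‿cong; +-identityˡ; +-identityʳ; *-identityˡ; zeroˡ; zeroʳ; *-comm; +-commutativeMonoid)
  open IsStrictTotalOrder isStrictTotalOrder using (_≟_; <-respˡ-≈; <-respʳ-≈)
  open IntegerSolver commutativeRing
  open OrderedField ℝ
  open HalfPlane ℝ
  open Exchange ℝ
  open RawMonoidDefs (RawRing.+-rawMonoid rawRing) using (sum)
  open SumProperties +-commutativeMonoid using (sum-cong-≋; ∑-distrib-+)

  module _ {ℓ} (ℬ : Pred (Subset n) ℓ) where

    vertex∈polytope : ∀ {B} → ℬ B → polytope ℝ ℬ (indicator ℝ B)
    vertex∈polytope {B} B∈ℬ = 1 , (λ _ → 1#) , (λ _ → indicator ℝ B) ,
      (λ _ → B , B∈ℬ , λ _ → refl) , (λ _ → inj₁ 0<1) , +-identityʳ 1# ,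
      λ i → sym (trans (+-identityʳ _) (*-identityˡ _))

  dot-+ : ∀ (a : Point ℝ n) {u v u′ v′} → (∀ k → u k + v k ≈ u′ k + v′ k) →
          dot ℝ a u + dot ℝ a v ≈ dot ℝ a u′ + dot ℝ a v′
  dot-+ a {u} {v} {u′} {v′} u+v≈u′+v′ = begin
    dot ℝ a u + dot ℝ a v          ≈⟨ ∑-distrib-+ (λ k → a k * u k) (λ k → a k * v k) ⟨
    sum (λ k → a k * u k + a k * v k)   ≈⟨ sum-cong-≋ (λ k → begin
      a k * u k + a k * v k     ≈⟨ solve 3 (λ a u v → a :* u :+ a :* v := a :* (u :+ v)) refl _ _ _ ⟩
      a k * (u k + v k)         ≈⟨ *-congˡ (u+v≈u′+v′ k) ⟩
      a k * (u′ k + v′ k)       ≈⟨ solve 3 (λ a u v → a :* (u :+ v) := a :* u :+ a :* v) refl _ _ _ ⟩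
      a k * u′ k + a k * v′ k   ∎) ⟩
    sum (λ k → a k * u′ k + a k * v′ k) ≈⟨ ∑-distrib-+ (λ k → a k * u′ k) (λ k → a k * v′ k) ⟩
    dot ℝ a u′ + dot ℝ a v′        ∎
    where open SetoidReasoning setoid

  bit : Bool → Carrier
  bit b = if b then 1# else 0#

  -- The endpoints differ in this coordinate, so its value determines the parameter.
  bit-on-segment⇒t≈0 : ∀ b {t} → bit b ≈ (1# + - t) * bit b + t * bit (not b) → t ≈ 0#
  bit-on-segment⇒t≈0 true {t} eq = begin
    t                             ≈⟨ solve 1 (λ t → t :=
                                       con (+ 1) :+ :- ((con (+ 1) :+ :- t) :* con (+ 1) :+ t :* con (+ 0))) refl t ⟩
    1# + - ((1# + - t) * 1# + t * 0#) ≈⟨ +-congˡ (-‿cong eq) ⟨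
    1# + - 1#                     ≈⟨ solve 0 (con (+ 1) :+ :- con (+ 1) := con (+ 0)) refl ⟩
    0#                            ∎
    where open SetoidReasoning setoid
  bit-on-segment⇒t≈0 false {t} eq = begin
    t                             ≈⟨ solve 1 (λ t → t := (con (+ 1) :+ :- t) :* con (+ 0) :+ t :* con (+ 1)) refl t ⟩
    (1# + - t) * 0# + t * 1#      ≈⟨ eq ⟨
    0#                            ∎
    where open SetoidReasoning setoid

  module _ {ℓ} {ℬ : Pred (Subset (suc (suc n))) ℓ} (i : Fin (suc (suc n))) (j : Fin (suc n)) (T : Subset n) where
    open Corner i j

    -- The two diagonals of a square have the same midpoint, so a face of the
    -- polytope that contains one of them contains the other.
    edge⇒antidiagonal∉ : ∀ {α β} →
      IsEdge ℝ (polytope ℝ ℬ) (indicator ℝ (corner i j T α β)) (indicator ℝ (corner i j T (not α) (not β))) →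
      ℬ (corner i j T α (not β)) → ¬ ℬ (corner i j T (not α) β)
    edge⇒antidiagonal∉ {α} {β} isEdge C∈ C′∈ = 0≉1 (trans (sym t≈0) t≈1)
      where
      open IsEdge isEdge
      A B C C′ : Point ℝ _
      A  = indicator ℝ (corner i j T α β)
      B  = indicator ℝ (corner i j T (not α) (not β))
      C  = indicator ℝ (corner i j T α (not β))
      C′ = indicator ℝ (corner i j T (not α) β)
      midpoint : ∀ k → C k + C′ k ≈ A k + B k
      midpoint k with lookup-corner k
      ... | inj₁ eq rewrite eq T α β | eq T (not α) (not β) | eq T α (not β) | eq T (not α) β = refl
      ... | inj₂ (inj₁ eq) rewrite eq T α β | eq T (not α) (not β) | eq T α (not β) | eq T (not α) β =
        +-comm _ _
      ... | inj₂ (inj₂ (_ , eq)) rewrite eq T α β | eq T (not α) (not β) | eq T α (not β) | eq T (not α) β = refl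
      A-tight : dot ℝ normal A ≈ bound
      A-tight = proj₂ (Equivalence.from (face A) (0# , inj₂ refl , inj₁ 0<1 , λ k →
        solve 2 (λ a b → a := (con (+ 1) :+ :- con (+ 0)) :* a :+ con (+ 0) :* b) refl (A k) (B k)))
      B-tight : dot ℝ normal B ≈ bound
      B-tight = proj₂ (Equivalence.from (face B) (1# , inj₁ 0<1 , inj₂ refl , λ k →
        solve 2 (λ a b → b := (con (+ 1) :+ :- con (+ 1)) :* a :+ con (+ 1) :* b) refl (A k) (B k)))
      C+C′≈2bound : dot ℝ normal C + dot ℝ normal C′ ≈ bound + bound
      C+C′≈2bound = trans (dot-+ normal midpoint) (+-cong A-tight B-tight)
      open SetoidReasoning setoid
      -- The gaps at `C` and at `C′` are nonnegative by validity and add up to zero, so both vanish.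
      gap≈0 : bound + - dot ℝ normal C ≈ 0#
      gap≈0 = 0≤-antisym (≤⇒0≤- (valid C (vertex∈polytope ℬ C∈))) (≤-resp-≈ (begin
        bound + - dot ℝ normal C′
          ≈⟨ solve 3 (λ b c c′ → b :+ :- c′ := (b :+ b) :+ :- (c :+ c′) :+ :- (b :+ :- c)) refl _ _ _ ⟩
        (bound + bound) + - (dot ℝ normal C + dot ℝ normal C′) + - (bound + - dot ℝ normal C)
          ≈⟨ +-congʳ (+-congˡ (-‿cong C+C′≈2bound)) ⟩
        (bound + bound) + - (bound + bound) + - (bound + - dot ℝ normal C)
          ≈⟨ solve 2 (λ b c → (b :+ b) :+ :- (b :+ b) :+ :- (b :+ :- c) := :- (b :+ :- c)) refl _ _ ⟩
        - (bound + - dot ℝ normal C) ∎)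
        (≤⇒0≤- (valid C′ (vertex∈polytope ℬ C′∈))))
      C-tight : dot ℝ normal C ≈ bound
      C-tight = begin
        dot ℝ normal C                            ≈⟨ solve 2 (λ b c → c := b :+ :- (b :+ :- c)) refl bound _ ⟩
        bound + - (bound + - dot ℝ normal C)      ≈⟨ +-congˡ (-‿cong gap≈0) ⟩
        bound + - 0#                              ≈⟨ solve 1 (λ b → b :+ :- con (+ 0) := b) refl bound ⟩
        bound                                     ∎
      C∈segment : segment ℝ A B C
      C∈segment = Equivalence.to (face C) (vertex∈polytope ℬ C∈ , C-tight)
      t = proj₁ C∈segment
      C-on-AB : ∀ k → C k ≈ (1# + - t) * A k + t * B k
      C-on-AB = proj₂ (proj₂ (proj₂ C∈segment))
      bit-cong : ∀ {x y} → x ≡ y → bit x ≈ bit y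
      bit-cong = reflexive ∘ ≡.cong bit
      -- `C` agrees with `A` at the coordinate `i` and with `B` at `punchIn i j`, which forces two
      -- different parameters.
      t≈0 : t ≈ 0#
      t≈0 = bit-on-segment⇒t≈0 α (begin
        bit α                            ≈⟨ bit-cong (lookup-cornerˡ T α (not β)) ⟨
        C i                              ≈⟨ C-on-AB i ⟩
        (1# + - t) * A i + t * B i       ≈⟨ +-cong (*-congˡ (bit-cong (lookup-cornerˡ T α β)))
                                                   (*-congˡ (bit-cong (lookup-cornerˡ T (not α) (not β)))) ⟩
        (1# + - t) * bit α + t * bit (not α) ∎)
      -- Traversed from `B` to `A`, the segment has the parameter `1# + - t`.
      1-t≈0 : 1# + - t ≈ 0#
      1-t≈0 = bit-on-segment⇒t≈0 (not β) (begin
        bit (not β)                      ≈⟨ bit-cong (lookup-cornerʳ T α (not β)) ⟨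
        C (punchIn i j)                  ≈⟨ C-on-AB (punchIn i j) ⟩
        (1# + - t) * A (punchIn i j) + t * B (punchIn i j)
          ≈⟨ +-cong (*-congˡ (bit-cong (≡.trans (lookup-cornerʳ T α β) (≡.sym (not-involutive β)))))
                    (*-congˡ (bit-cong (lookup-cornerʳ T (not α) (not β)))) ⟩
        (1# + - t) * bit (not (not β)) + t * bit (not β)
          ≈⟨ solve 3 (λ t x y → (con (+ 1) :+ :- t) :* x :+ t :* y :=
               (con (+ 1) :+ :- (con (+ 1) :+ :- t)) :* y :+ (con (+ 1) :+ :- t) :* x) refl t _ _ ⟩
        (1# + - (1# + - t)) * bit (not β) + (1# + - t) * bit (not (not β)) ∎)
      t≈1 : t ≈ 1#
      t≈1 = begin
        t                 ≈⟨ solve 1 (λ t → t := con (+ 1) :+ :- (con (+ 1) :+ :- t)) refl t ⟩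
        1# + - (1# + - t) ≈⟨ +-congˡ (-‿cong 1-t≈0) ⟩
        1# + - 0#         ≈⟨ solve 0 (con (+ 1) :+ :- con (+ 0) := con (+ 1)) refl ⟩
        1#                ∎

  sign-pos : ∀ {x} .(x≉0 : ¬ (x ≈ 0#)) → 0# < x → sign ℝ x x≉0 ≡ Sign.+
  sign-pos {x} x≉0 0<x with compare x 0#
  ... | tri< _ _ x≯0 = contradiction 0<x x≯0
  ... | tri≈ _ _ x≯0 = contradiction 0<x x≯0
  ... | tri> _ _ _   = ≡.refl

  sign-neg : ∀ {x} .(x≉0 : ¬ (x ≈ 0#)) → x < 0# → sign ℝ x x≉0 ≡ Sign.-
  sign-neg {x} x≉0 x<0 with compare x 0#
  ... | tri< _ _ _   = ≡.refl
  ... | tri≈ x≮0 _ _ = contradiction x<0 x≮0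
  ... | tri> x≮0 _ _ = contradiction x<0 x≮0

  x≉0⇒x≷0 : ∀ {x} → ¬ (x ≈ 0#) → x < 0# ⊎ 0# < x
  x≉0⇒x≷0 {x} x≉0 with compare x 0#
  ... | tri< x<0 _ _ = inj₁ x<0
  ... | tri≈ _ x≈0 _ = contradiction x≈0 x≉0
  ... | tri> _ _ 0<x = inj₂ 0<x

  -- The Rayleigh inequality speaks of products of coefficients; this translates between their signs
  -- and relations of signs.
  sign-cases : ∀ {x y} (x≉0 : ¬ (x ≈ 0#)) (y≉0 : ¬ (y ≈ 0#)) →
    (0# < x * y × sign ℝ x x≉0 ≡ sign ℝ y y≉0) ⊎
    (x * y < 0# × sign ℝ x x≉0 ≡ opposite (sign ℝ y y≉0))
  sign-cases {x} {y} x≉0 y≉0 with x≉0⇒x≷0 x≉0 | x≉0⇒x≷0 y≉0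
  ... | inj₁ x<0 | inj₁ y<0 rewrite sign-neg x≉0 x<0 | sign-neg y≉0 y<0 =
    inj₁ (<-respʳ-≈ (solve 2 (λ x y → :- x :* :- y := x :* y) refl x y) (*-pos (x<0⇒0<-x x<0) (x<0⇒0<-x y<0)) , ≡.refl)
  ... | inj₁ x<0 | inj₂ 0<y rewrite sign-neg x≉0 x<0 | sign-pos y≉0 0<y =
    inj₂ (<-respˡ-≈ (*-comm y x) (*-pos-neg 0<y x<0) , ≡.refl)
  ... | inj₂ 0<x | inj₁ y<0 rewrite sign-pos x≉0 0<x | sign-neg y≉0 y<0 =
    inj₂ (*-pos-neg 0<x y<0 , ≡.refl)
  ... | inj₂ 0<x | inj₂ 0<y rewrite sign-pos x≉0 0<x | sign-pos y≉0 0<y =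
    inj₁ (*-pos 0<x 0<y , ≡.refl)

  0≤xy⇒sign-≡ : ∀ {x y} (x≉0 : ¬ (x ≈ 0#)) (y≉0 : ¬ (y ≈ 0#)) → 0# ≤ x * y → sign ℝ x x≉0 ≡ sign ℝ y y≉0
  0≤xy⇒sign-≡ x≉0 y≉0 0≤xy with sign-cases x≉0 y≉0
  ... | inj₁ (_ , eq)    = eq
  ... | inj₂ (xy<0 , _)  = contradiction xy<0 (0≤⇒≮ 0≤xy)

  0≤-xy⇒sign-opposite : ∀ {x y} (x≉0 : ¬ (x ≈ 0#)) (y≉0 : ¬ (y ≈ 0#)) → 0# ≤ - (x * y) →
    sign ℝ x x≉0 ≡ opposite (sign ℝ y y≉0)
  0≤-xy⇒sign-opposite x≉0 y≉0 0≤-xy with sign-cases x≉0 y≉0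
  ... | inj₂ (_ , eq)   = eq
  ... | inj₁ (0<xy , _) = contradiction (0≤-antisym (inj₁ 0<xy) 0≤-xy) (pos⇒≉0 0<xy)

  s≢opposite[s] : ∀ s → s ≢ opposite s
  s≢opposite[s] Sign.+ ()
  s≢opposite[s] Sign.- ()

  sign-≡⇒0<xy : ∀ {x y} (x≉0 : ¬ (x ≈ 0#)) (y≉0 : ¬ (y ≈ 0#)) → sign ℝ x x≉0 ≡ sign ℝ y y≉0 → 0# < x * y
  sign-≡⇒0<xy x≉0 y≉0 same with sign-cases x≉0 y≉0
  ... | inj₁ (0<xy , _) = 0<xy
  ... | inj₂ (_ , opp)  = contradiction (≡.trans (≡.sym same) opp) (s≢opposite[s] _)

  sign-opposite⇒xy<0 : ∀ {x y} (x≉0 : ¬ (x ≈ 0#)) (y≉0 : ¬ (y ≈ 0#)) →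
    sign ℝ x x≉0 ≡ opposite (sign ℝ y y≉0) → x * y < 0#
  sign-opposite⇒xy<0 x≉0 y≉0 opp with sign-cases x≉0 y≉0
  ... | inj₂ (xy<0 , _) = xy<0
  ... | inj₁ (_ , same) = contradiction (≡.trans (≡.sym same) opp) (s≢opposite[s] _)

  -- Splitting off the coordinate `i`, where `Y` has the opposite value of `X`, brings both sets
  -- into the form of `exchange-insertAt`.
  supp-exchange : ∀ (f : Subset n → Carrier) → RealStable ℝ f →
    ∀ {X Y} → ¬ (f X ≈ 0#) → ¬ (f Y ≈ 0#) → ∀ {i} → i ∈ X △ Y →
    ∃[ j ] j ∈ X △ Y × ¬ (f (X △ (⁅ i ⁆ ∪ ⁅ j ⁆)) ≈ 0#)
  supp-exchange {suc n} f stable {X} {Y} fX≉0 fY≉0 {i} i∈ =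
    ≡.subst₂ (λ X Y → ∃[ j ] j ∈ X △ Y × ¬ (f (X △ (⁅ i ⁆ ∪ ⁅ j ⁆)) ≈ 0#)) X≡ Y≡
      (exchange-insertAt f stable i (removeAt X i) (removeAt Y i) (lookup X i)
        (≡.subst (λ X → ¬ (f X ≈ 0#)) (≡.sym X≡) fX≉0) (≡.subst (λ Y → ¬ (f Y ≈ 0#)) (≡.sym Y≡) fY≉0))
    where
    X≡ : insertAt (removeAt X i) i (lookup X i) ≡ X
    X≡ = insertAt-removeAt X i
    Y≡ : insertAt (removeAt Y i) i (not (lookup X i)) ≡ Y
    Y≡ = ≡.trans (≡.cong (insertAt (removeAt Y i) i) (≡.sym (∈△⇒lookup-not i∈))) (insertAt-removeAt Y i)

  module Square (f : Subset (suc (suc n)) → Carrier) (stable : RealStable ℝ f)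
                (i : Fin (suc (suc n))) (j : Fin (suc n)) (T : Subset n) where
    open Corner i j

    a : Bool → Bool → Carrier
    a α β = f (corner i j T α β)

    rayleigh : 0# ≤ a outside inside * a inside outside + - (a outside outside * a inside inside)
    rayleigh = Interlacing-vertex _ _ (stable⇒Interlacing f stable i) j T

    -- A nonzero product would make both vertices of the other diagonal bases.
    edge⇒antidiagonal≈0 : ∀ α β →
      LongEdge ℝ (supp rawRing f) (corner i j T α β) (corner i j T (not α) (not β)) →
      a α (not β) * a (not α) β ≈ 0#
    edge⇒antidiagonal≈0 α β (isEdge , _) = decidable-stable (_ ≟ 0#) λ aa≉0 →
      edge⇒antidiagonal∉ i j T isEdge
        (λ a≈0 → aa≉0 (trans (*-congʳ a≈0) (zeroˡ _))) (λ a≈0 → aa≉0 (trans (*-congˡ a≈0) (zeroʳ _)))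

    main≈0⇒0≤anti : a outside outside * a inside inside ≈ 0# → 0# ≤ a outside inside * a inside outside
    main≈0⇒0≤anti eq = ≤-resp-≈ (trans (+-congˡ (-‿cong eq))
      (solve 1 (λ x → x :+ :- con (+ 0) := x) refl _)) rayleigh

    anti≈0⇒0≤-main : a outside inside * a inside outside ≈ 0# → 0# ≤ - (a outside outside * a inside inside)
    anti≈0⇒0≤-main eq = ≤-resp-≈ (trans (+-congʳ eq) (+-identityˡ _)) rayleigh

    ¬anti<0<main : a outside inside * a inside outside < 0# → ¬ (0# < a outside outside * a inside inside)
    ¬anti<0<main anti<0 0<main = 0≤⇒≮ rayleigh (0<-x⇒x<0 (<-respʳ-≈
      (solve 2 (λ x y → :- x :+ y := :- (x :+ :- y)) refl _ _) (+-pos (x<0⇒0<-x anti<0) 0<main)))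

  ∣△⊥∣ : ∀ (X : Subset n) → ∣ X △ ⊥ ∣ ≡ ∣ X ∣
  ∣△⊥∣ X = ≡.cong ∣_∣ (△-identityʳ X)

  ∣oo∣≢∣ii∣ : ∀ (i : Fin (suc (suc n))) j T →
    ∣ corner i j T outside outside △ ⊥ ∣ ≢ ∣ corner i j T inside inside △ ⊥ ∣
  ∣oo∣≢∣ii∣ i j T eq = ℕ.m≢1+n+m ∣ T ∣ (≡.trans (≡.sym (∣corner∣-oo T))
    (≡.trans (≡.sym (∣△⊥∣ (corner i j T outside outside)))
      (≡.trans eq (≡.trans (∣△⊥∣ (corner i j T inside inside)) (∣corner∣-ii T)))))
    where open Corner i j

  ∣oi∣≡∣io∣ : ∀ (i : Fin (suc (suc n))) j T →
    ∣ corner i j T outside inside △ ⊥ ∣ ≡ ∣ corner i j T inside outside △ ⊥ ∣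
  ∣oi∣≡∣io∣ i j T = ≡.trans (∣△⊥∣ (corner i j T outside inside)) (≡.trans (∣corner∣-oi T)
    (≡.sym (≡.trans (∣△⊥∣ (corner i j T inside outside)) (∣corner∣-io T))))
    where open Corner i j

  -- Distance from the empty set is cardinality, so the edge joins the two middle corners of its
  -- square. The product over the smallest and largest corners vanishes, and the Rayleigh inequality
  -- makes the other product nonnegative.
  horizontal⇒sign-≡ : ∀ (f : Subset n → Carrier) → RealStable ℝ f →
    ∀ {A B} (A∈ : ¬ (f A ≈ 0#)) (B∈ : ¬ (f B ≈ 0#)) →
    HorizontalLongEdge ℝ (supp rawRing f) ⊥ A B → sign ℝ (f A) A∈ ≡ sign ℝ (f B) B∈
  horizontal⇒sign-≡ f stable {A} {B} A∈ B∈ (e@(_ , ∣A△B∣≡2) , ∣A∣≡∣B∣) with ∣A△B∣≡2⇒Diagonal A B ∣A△B∣≡2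
  ... | diagonal i j T false false = contradiction ∣A∣≡∣B∣ (∣oo∣≢∣ii∣ i j T)
  ... | diagonal i j T true  true  = contradiction (≡.sym ∣A∣≡∣B∣) (∣oo∣≢∣ii∣ i j T)
  ... | diagonal i j T false true  = 0≤xy⇒sign-≡ A∈ B∈ (main≈0⇒0≤anti (edge⇒antidiagonal≈0 false true e))
    where open Square f stable i j T
  ... | diagonal i j T true  false = 0≤xy⇒sign-≡ A∈ B∈ (≤-resp-≈ (*-comm _ _)
      (main≈0⇒0≤anti (trans (*-comm _ _) (edge⇒antidiagonal≈0 true false e))))
    where open Square f stable i j T

  -- Now the edge joins the smallest and largest corners. The product over the middle corners
  -- vanishes, so theirs is nonpositive.
  vertical⇒sign-opposite : ∀ (f : Subset n → Carrier) → RealStable ℝ f →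
    ∀ {A B} (A∈ : ¬ (f A ≈ 0#)) (B∈ : ¬ (f B ≈ 0#)) →
    VerticalLongEdge ℝ (supp rawRing f) ⊥ A B → sign ℝ (f A) A∈ ≡ opposite (sign ℝ (f B) B∈)
  vertical⇒sign-opposite f stable {A} {B} A∈ B∈ (e@(_ , ∣A△B∣≡2) , ∣A∣≢∣B∣) with ∣A△B∣≡2⇒Diagonal A B ∣A△B∣≡2
  ... | diagonal i j T false true  = contradiction (∣oi∣≡∣io∣ i j T) ∣A∣≢∣B∣
  ... | diagonal i j T true  false = contradiction (≡.sym (∣oi∣≡∣io∣ i j T)) ∣A∣≢∣B∣
  ... | diagonal i j T false false = 0≤-xy⇒sign-opposite A∈ B∈ (anti≈0⇒0≤-main (edge⇒antidiagonal≈0 false false e))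
    where open Square f stable i j T
  ... | diagonal i j T true  true  = 0≤-xy⇒sign-opposite A∈ B∈ (≤-resp-≈ (-‿cong (*-comm _ _))
      (anti≈0⇒0≤-main (trans (*-comm _ _) (edge⇒antidiagonal≈0 true true e))))
    where open Square f stable i j T

  module _ (f : Subset (suc (suc n)) → Carrier) (stable : RealStable ℝ f)
           (i : Fin (suc (suc n))) (j : Fin (suc n)) (T : Subset (suc (suc n))) where
    open Corner i j
    open Square f stable i j (base T)

    Face : Pred (Subset (suc (suc n))) _
    Face = CubeFace (corner i j ⊥ inside inside) T

    oo-closest : Closest ⊥ Face (corner i j (base T) outside outside)
    oo-closest W W∈ = ≡.subst₂ ℕ._≤_ (≡.sym (∣△⊥∣ (corner i j (base T) outside outside)))
      (≡.trans (≡.cong ∣_∣ (≡.sym (face⇒corner T W W∈))) (≡.sym (∣△⊥∣ W))) (∣corner∣≥ (base T) _ _)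

    ii-furthest : Furthest ⊥ Face (corner i j (base T) inside inside)
    ii-furthest W W∈ = ≡.subst₂ ℕ._≤_
      (≡.trans (≡.cong ∣_∣ (≡.sym (face⇒corner T W W∈))) (≡.sym (∣△⊥∣ W)))
      (≡.sym (∣△⊥∣ (corner i j (base T) inside inside))) (∣corner∣≤ (base T) _ _)

    module _ (bases : ∀ V → Face V → ¬ (f V ≈ 0#)) where
      s : ∀ V → Face V → Sign
      s V V∈ = sign ℝ (f V) (bases V V∈)

      corner≉0 : ∀ α β → ¬ (a α β ≈ 0#)
      corner≉0 α β = bases _ (corner∈face T α β)

      -- If a middle corner were the odd one, the product over the middle corners would be negative
      -- and the product over the smallest and largest corners positive, against the Rayleigh
      -- inequality.
      odd⇒closest⊎furthest : ∀ α β {V} → V ≡ corner i j (base T) α β → (V∈ : Face V) →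
        (∀ W (W∈ : Face W) → W ≢ V → s W W∈ ≡ opposite (s V V∈)) →
        Closest ⊥ Face V ⊎ Furthest ⊥ Face V
      odd⇒closest⊎furthest false false ≡.refl V∈ odd = inj₁ oo-closest
      odd⇒closest⊎furthest true  true  ≡.refl V∈ odd = inj₂ ii-furthest
      odd⇒closest⊎furthest false true  ≡.refl V∈ odd = contradiction
        (sign-≡⇒0<xy (corner≉0 _ _) (corner≉0 _ _)
          (≡.trans (odd _ (corner∈face T false false) (λ eq → contradiction (corner-injectiveʳ eq) λ ()))
            (≡.sym (odd _ (corner∈face T true true) (λ eq → contradiction (corner-injectiveˡ eq) λ ())))))
        (¬anti<0<main (<-respˡ-≈ (*-comm _ _) (sign-opposite⇒xy<0 (corner≉0 true false) (corner≉0 false true)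
          (odd _ (corner∈face T true false) (λ eq → contradiction (corner-injectiveˡ eq) λ ())))))
      odd⇒closest⊎furthest true  false ≡.refl V∈ odd = contradiction
        (sign-≡⇒0<xy (corner≉0 _ _) (corner≉0 _ _)
          (≡.trans (odd _ (corner∈face T false false) (λ eq → contradiction (corner-injectiveˡ eq) λ ()))
            (≡.sym (odd _ (corner∈face T true true) (λ eq → contradiction (corner-injectiveʳ eq) λ ())))))
        (¬anti<0<main (sign-opposite⇒xy<0 (corner≉0 false true) (corner≉0 true false)
          (odd _ (corner∈face T false true) (λ eq → contradiction (corner-injectiveˡ eq) λ ()))))

  square⇒closest⊎furthest : ∀ (f : Subset n → Carrier) → RealStable ℝ f → ∀ D T → ∣ D ∣ ≡ 2 →
    (bases : ∀ V → CubeFace D T V → ¬ (f V ≈ 0#)) → ∀ V (V∈ : CubeFace D T V) →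
    (∀ W (W∈ : CubeFace D T W) → W ≢ V → sign ℝ (f W) (bases W W∈) ≡ opposite (sign ℝ (f V) (bases V V∈))) →
    Closest ⊥ (CubeFace D T) V ⊎ Furthest ⊥ (CubeFace D T) V
  square⇒closest⊎furthest f stable D T ∣D∣≡2 bases V V∈ odd with ∣p∣≡2⇒TwoElements D ∣D∣≡2
  ... | pair i j = odd⇒closest⊎furthest f stable i j T bases _ _ (Corner.face⇒corner i j T V V∈) V∈ odd

theorem3p1 : ∀ {c ℓ₁ ℓ₂} (ℝ : RealNumbers c ℓ₁ ℓ₂) → let open RealNumbers ℝ in
    (n : ℕ) (f : Multiaffine rawRing n) →
    RealStable ℝ f →
    0# < f ⊥ →
    IsOrientation ℝ (supp rawRing f) ⊥ (coefficientSign ℝ f)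
theorem3p1 ℝ n f stable 0<f⊥ = record
  { isΔMatroid = record { nonempty = ⊥ , f⊥≉0 ; exchange = supp-exchange f stable }
  ; reference  = f⊥≉0
  ; horizontal = horizontal⇒sign-≡ f stable
  ; vertical   = vertical⇒sign-opposite f stable
  ; square     = square⇒closest⊎furthest f stable
  ; positive   = sign-pos f⊥≉0 0<f⊥
  }
  where
  open RealNumbers ℝ
  open Orientation ℝ
  f⊥≉0 : ¬ (f ⊥ ≈ 0#)
  f⊥≉0 = OrderedField.pos⇒≉0 ℝ 0<f⊥
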